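{- As algebras over the operad $\mathcal{SP}$, the algebra of shuffle series $\{\mathcal{SH}(P)\}$ ($P$ ranging over $SP$-posets) is isomorphic to the algebra of weak order series $\{\mathfrak{Z}^+(P)\}$. Moreover, for every $SP$-poset $P$ with $n=|P|$, if $$\mathfrak{Z}^+(P)=\sum_{i=1}^{n}(-1)^{n-i}d_{P,i}\,\mathfrak{Z}^+(i),$$ then $$\mathcal{SH}(P)=\sum_{i=1}^{n}(-1)^{n-i}d_{P,i}\,\mathcal{SH}(i).$$
   Context: Posets are finite and considered up to isomorphism. $\langle n\rangle$ is the chain $1<2<\cdots<n$ ($\langle 0\rangle$ is empty). $P\sqcup Q$ is the disjoint union of posets; $P\oplus Q$ is the ordinal sum (every element of $P$ below every element of $Q$). An $SP$-poset is a poset obtained from one-point posets by finitely many applications of $\sqcup$ and $\oplus$. Weak order series. $\mathfrak{Z}^+(P)=\sum_{n\ge 1}\Omega(P,n)x^n$, where $\Omega(P,n)$ is the number of weakly order-preserving maps $P\to\langle n\rangle$ ($x\le y\Rightarrow f(x)\le f(y)$); $\mathfrak{Z}^+(i):=\mathfrak{Z}^+(\langle i\rangle)=\frac{x}{(1-x)^{i+1}}$. The integers $d_{P,i}$ are defined by $\Omega^\circ(P,x)=\sum_{i=1}^{|P|}d_{P,i}\binom{x}{i}$, where $\Omega^\circ(P,n)$ is the number of strict order-preserving maps $P\to \langle n\rangle$ ($x<y\Rightarrow f(x)<f(y)$). Shuffle series. A (colimit-indexing) shuffle of an $SP$-poset $P$ and $\langle n\rangle$ is a finite poset $A$ such that: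 every point of $A$ is labeled by a point of $P$ or a point of $\langle n\rangle$; $A$ has the same number of minimal points as $P$ and the same number of maximal points as $P$; and there is a bijection $M\mapsto A_M$ from maximal chains of $P$ to maximal chains of $A$ such that the labels along $A_M$ list every element of $M$ and every element of $\langle n\rangle$ exactly once, preserving the order of $M$ and of $\langle n\rangle$. Every point of $P$ labels exactly one point of $A$ (a point of $\langle n\rangle$ may label several), and two shuffles are identified if for every $M$ the label sequences along the corresponding chains coincide. $\mathcal{SH}(P)=\sum_{n\ge 0}\#\hom_{Shuffle}(P,\langle n\rangle)x^n$, where $\hom_{Shuffle}(P,\langle n\rangle)$ is the set of these shuffles (one shuffle if $n=0$), and $\mathcal{SH}(i):=\mathcal{SH}(\langle i\rangle)$. An algebra over $\mathcal{SP}$ here is a set with an action of the operations generated by the two binary operations $\sqcup$ and $\oplus$. On shuffle series, $\sqcup$ acts by the Hadamard (coefficientwise) product and $\oplus$ by $(f,g)\mapsto f(1-x)g$. On weak order series, $\sqcup$ acts by the Hadamard product and $\oplus$ by $(f,g)\mapsto f\frac{1-x}{x}g$. In each case the action satisfies that the operation $\sqcup$ (resp. $\oplus$) applied to the series of $P$ and $Q$ is the series of $P\sqcup Q$ (resp. $P\oplus Q$). An isomorphism of such algebras is a bijection commuting with both operations. -}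

module Defs where

open import Level using (Level; 0ℓ) renaming (_⊔_ to _⊔ℓ_; suc to sucℓ)
open import Algebra.Bundles.Raw using (RawMagma)
open import Algebra.Core using (Op₂)
open import Algebra.Morphism.Structures using (module MagmaMorphisms)
import Algebra.Properties.Semiring.Sum as SemiringSum
open import Data.Fin.Base as Fin using (Fin; zero; suc; toℕ)
import Data.Fin.Properties as Fin
open import Data.Integer.Base as ℤ using (ℤ; +_; -1ℤ; 0ℤ; 1ℤ)
import Data.Integer.Properties as ℤ
open import Data.List.Base using (List; map; allFin)
open import Data.List.Relation.Binary.Subset.Propositional using (_⊆_)
open import Data.List.Relation.Ternary.Interleaving.Propositional using (Interleaving)
open import Data.List.Relation.Unary.Linked using (Linked)
open import Data.Nat.Base as ℕ using (ℕ; zero; suc; _∸_; s≤s; z≤n)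
open import Data.Nat.Combinatorics using (_C_)
open import Data.Product using (Σ-syntax; ∃; ∃-syntax; ∃!; _×_; _,_; proj₁; proj₂)
open import Data.Sum.Base using (_⊎_; inj₁; inj₂)
open import Data.Sum.Relation.Binary.LeftOrder
  using (_⊎-<_; ₁∼₂; ₁∼₁; ₂∼₂; ⊎-<-isPartialOrder; ⊎-<-decidable)
open import Data.Sum.Relation.Binary.Pointwise
  using (Pointwise; Pointwise-≡⇒≡; ≡⇒Pointwise-≡; ⊎-isPartialOrder; ⊎-decidable)
open import Function.Bundles using (_↔_; Bijection)
open import Function.Construct.Identity using (↔-id)
open import Function.Construct.Composition using (_↔-∘_)
open import Data.Sum.Function.Propositional using (_⊎-↔_)
open import Relation.Binary.Bundles using (Setoid)
open import Relation.Binary.Core using (Rel; _Preserves_⟶_)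
open import Relation.Binary.Definitions using (Decidable)
open import Relation.Binary.Structures using (IsPartialOrder; IsDecPartialOrder; IsDecTotalOrder)
import Relation.Binary.Construct.NonStrictToStrict as ToStrict
import Relation.Binary.Construct.On as On
open import Relation.Binary.Morphism.Structures using (IsOrderIsomorphism)
open import Relation.Binary.PropositionalEquality
  using (_≡_; refl; cong; _≗_; _→-setoid_)
import Relation.Binary.PropositionalEquality.Properties as ≡
import Relation.Nullary.Decidable as Dec

------------------------------------------------------------------------
-- Finite posets

record FinPoset : Set₁ where
  infix 4 _≤_
  field
    Carrier           : Set
    _≤_               : Rel Carrier 0ℓ
    isDecPartialOrder : IsDecPartialOrder _≡_ _≤_
    size              : ℕ
    enumeration       : Fin size ↔ Carrier

  open IsDecPartialOrder isDecPartialOrder public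
    using (isPartialOrder; _≤?_; _≟_)
  open ToStrict _≡_ _≤_ public using (_<_)

⟨_⟩ : ℕ → FinPoset
⟨ n ⟩ = record
  { Carrier           = Fin n
  ; _≤_               = Fin._≤_
  ; isDecPartialOrder = IsDecTotalOrder.isDecPartialOrder Fin.≤-isDecTotalOrder
  ; size              = n
  ; enumeration       = ↔-id (Fin n)
  }

module _ (P Q : FinPoset) where
  private
    module P = FinPoset P
    module Q = FinPoset Q

    sum-isDecPartialOrder : {_≤_ : Rel (P.Carrier ⊎ Q.Carrier) 0ℓ} →
      IsPartialOrder (Pointwise _≡_ _≡_) _≤_ → Decidable _≤_ → IsDecPartialOrder _≡_ _≤_
    sum-isDecPartialOrder po dec = record
      { isPartialOrder = record
        { isPreorder = record
          { isEquivalence = ≡.isEquivalence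
          ; reflexive     = λ { refl → po.refl }
          ; trans         = po.trans
          }
        ; antisym = λ x≤y y≤x → Pointwise-≡⇒≡ (po.antisym x≤y y≤x)
        }
      ; _≟_  = λ x y → Dec.map′ Pointwise-≡⇒≡ ≡⇒Pointwise-≡ (⊎-decidable P._≟_ Q._≟_ x y)
      ; _≤?_ = dec
      }
      where module po = IsPartialOrder po

    sum-enumeration : Fin (P.size ℕ.+ Q.size) ↔ (P.Carrier ⊎ Q.Carrier)
    sum-enumeration = (P.enumeration ⊎-↔ Q.enumeration) ↔-∘ Fin.+↔⊎

  infixr 6 _⊔_
  _⊔_ : FinPoset
  _⊔_ = record
    { _≤_               = Pointwise P._≤_ Q._≤_
    ; isDecPartialOrder = sum-isDecPartialOrder
        (⊎-isPartialOrder P.isPartialOrder Q.isPartialOrder) (⊎-decidable P._≤?_ Q._≤?_)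
    ; enumeration       = sum-enumeration
    }

  infixr 6 _⊕_
  _⊕_ : FinPoset
  _⊕_ = record
    { _≤_               = P._≤_ ⊎-< Q._≤_
    ; isDecPartialOrder = sum-isDecPartialOrder
        (⊎-<-isPartialOrder P.isPartialOrder Q.isPartialOrder) (⊎-<-decidable P._≤?_ Q._≤?_)
    ; enumeration       = sum-enumeration
    }

infix 4 _≅_
_≅_ : FinPoset → FinPoset → Set
P ≅ Q = ∃ (IsOrderIsomorphism _≡_ _≡_ (FinPoset._≤_ P) (FinPoset._≤_ Q))

data SP : FinPoset → Set₁ where
  one     : SP ⟨ 1 ⟩
  union   : ∀ {P Q} → SP P → SP Q → SP (P ⊔ Q)
  ordinal : ∀ {P Q} → SP P → SP Q → SP (P ⊕ Q)
  resp    : ∀ {P Q} → P ≅ Q → SP P → SP Q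

chain-SP : ∀ i → SP ⟨ suc i ⟩
chain-SP zero    = one
chain-SP (suc i) = resp (f , iso) (ordinal one (chain-SP i))
  where
  f : Fin 1 ⊎ Fin (suc i) → Fin (suc (suc i))
  f (inj₁ _) = zero
  f (inj₂ j) = suc j

  iso : IsOrderIsomorphism _≡_ _≡_ (FinPoset._≤_ (⟨ 1 ⟩ ⊕ ⟨ suc i ⟩)) Fin._≤_ f
  iso = record
    { isOrderMonomorphism = record
      { isOrderHomomorphism = record
        { cong = cong f
        ; mono = λ { ₁∼₂ → z≤n ; (₁∼₁ _) → z≤n ; (₂∼₂ p) → s≤s p }
        }
      ; injective = λ { {inj₁ zero} {inj₁ zero} _ → refl ; {inj₂ _} {inj₂ _} refl → refl }
      ; cancel = λ { {inj₁ zero} {inj₁ zero} _ → ₁∼₁ z≤n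
                   ; {inj₁ _} {inj₂ _} _ → ₁∼₂
                   ; {inj₂ _} {inj₂ _} (s≤s p) → ₂∼₂ p }
      }
    ; surjective = λ { zero    → inj₁ zero , λ { refl → refl }
                     ; (suc j) → inj₂ j    , λ { refl → refl } }
    }

------------------------------------------------------------------------
-- Counting

private
  variable
    a b ℓ ℓ′ : Level

HasSize : Setoid a ℓ → ℤ → Set (a ⊔ℓ ℓ)
HasSize S z = ∃[ k ] z ≡ + k × Bijection (≡.setoid (Fin k)) S

SameSize : Setoid a ℓ → Setoid b ℓ′ → Set (a ⊔ℓ b ⊔ℓ ℓ ⊔ℓ ℓ′)
SameSize = Bijection

module _ (P : FinPoset) (n : ℕ) where
  private
    module P = FinPoset P
    module N = FinPoset ⟨ n ⟩

  WeakMaps : Setoid 0ℓ 0ℓ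
  WeakMaps = On.setoid {B = Σ[ f ∈ (P.Carrier → Fin n) ] f Preserves P._≤_ ⟶ N._≤_}
                       (P.Carrier →-setoid Fin n) proj₁

  StrictMaps : Setoid 0ℓ 0ℓ
  StrictMaps = On.setoid {B = Σ[ f ∈ (P.Carrier → Fin n) ] f Preserves P._<_ ⟶ N._<_}
                         (P.Carrier →-setoid Fin n) proj₁

------------------------------------------------------------------------
-- Minimal and maximal points, maximal chains

module _ (P : FinPoset) where
  open FinPoset P

  MinimalPoints : Setoid 0ℓ 0ℓ
  MinimalPoints = On.setoid {B = Σ[ x ∈ Carrier ] (∀ y → y ≤ x → y ≡ x)} (≡.setoid Carrier) proj₁

  MaximalPoints : Setoid 0ℓ 0ℓ
  MaximalPoints = On.setoid {B = Σ[ x ∈ Carrier ] (∀ y → x ≤ y → x ≡ y)} (≡.setoid Carrier) proj₁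

  -- A chain is given by the list of its elements in increasing order.
  IsChain : List Carrier → Set
  IsChain = Linked _<_

  record MaximalChain : Set where
    field
      elements : List Carrier
      isChain  : IsChain elements
      maximal  : ∀ {xs} → IsChain xs → elements ⊆ xs → xs ⊆ elements

  MaximalChains : Setoid 0ℓ 0ℓ
  MaximalChains = On.setoid (≡.setoid (List Carrier)) MaximalChain.elements

------------------------------------------------------------------------
-- Shuffles

record Shuffle (P : FinPoset) (n : ℕ) : Set₁ where
  private module P = FinPoset P
  field
    poset : FinPoset
  private module A = FinPoset poset
  field
    label       : A.Carrier → P.Carrier ⊎ Fin n
    sameMinimal : SameSize (MinimalPoints P) (MinimalPoints poset)
    sameMaximal : SameSize (MaximalPoints P) (MaximalPoints poset)
    chains      : Bijection (MaximalChains P) (MaximalChains poset)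

  labels : MaximalChain P → List (P.Carrier ⊎ Fin n)
  labels M = map label (MaximalChain.elements (Bijection.to chains M))

  field
    shuffles  : ∀ M → Interleaving (map inj₁ (MaximalChain.elements M))
                                   (map inj₂ (allFin n))
                                   (labels M)
    labelOnce : ∀ p → ∃! _≡_ λ x → label x ≡ inj₁ p

homShuffle : FinPoset → ℕ → Setoid (sucℓ 0ℓ) 0ℓ
homShuffle P n = record
  { Carrier       = Shuffle P n
  ; _≈_           = λ A B → Shuffle.labels A ≗ Shuffle.labels B
  ; isEquivalence = On.isEquivalence Shuffle.labels
      (Setoid.isEquivalence (MaximalChain P →-setoid List (FinPoset.Carrier P ⊎ Fin n)))
  }

------------------------------------------------------------------------
-- Power series, as coefficient sequences

open SemiringSum ℤ.+-*-semiring public using (sum-syntax; sum⁺-syntax)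

Series : Set
Series = ℕ → ℤ

infixl 7 _⊙_ _·_

_⊙_ : Op₂ Series
(f ⊙ g) n = f n ℤ.* g n

_·_ : Op₂ Series
(f · g) n = ∑[ i ≤ n ] (f (toℕ i) ℤ.* g (n ∸ toℕ i))

1-x : Series
1-x 0             = 1ℤ
1-x 1             = -1ℤ
1-x (suc (suc _)) = 0ℤ

-- Division by x, meaningful on series with zero constant term.
_/x : Series → Series
(f /x) n = f (suc n)

_⊛_ : Op₂ Series
f ⊛ g = f · 1-x · g

-- f ((1 - x)/x) g.  Weak order series have no constant term, so on them the
-- division by x is exact.
_⊛⁺_ : Op₂ Series
f ⊛⁺ g = (f · 1-x · g) /x

IsWeakOrderSeries : FinPoset → Series → Set
IsWeakOrderSeries P f = f 0 ≡ 0ℤ × (∀ n → HasSize (WeakMaps P (suc n)) (f (suc n)))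

IsShuffleSeries : FinPoset → Series → Set₁
IsShuffleSeries P f = ∀ n → HasSize (homShuffle P n) (f n)

-- The sum over 1 ≤ i ≤ |P| of c i.
∑[1…∣_∣] : FinPoset → (ℕ → ℤ) → ℤ
∑[1…∣ P ∣] c = ∑[ i < FinPoset.size P ] c (suc (toℕ i))

-- d is the family d_{P,i} of coefficients of the strict order polynomial of P
-- in the binomial basis; only the values d i with 1 ≤ i ≤ |P| matter.
IsStrictCoefficients : FinPoset → (ℕ → ℤ) → Set
IsStrictCoefficients P d =
  ∀ n → HasSize (StrictMaps P n) (∑[1…∣ P ∣] λ i → d i ℤ.* + (n C i))

------------------------------------------------------------------------
-- Algebras of series over the operations ⊔ and ⊕

record SeriesAlgebra {ℓ} (IsSeriesOf : FinPoset → Series → Set ℓ)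
                     (_∙⊔_ _∙⊕_ : Op₂ Series) : Set (sucℓ 0ℓ ⊔ℓ ℓ) where
  field
    series   : ∀ {P} → SP P → Series
    isSeries : ∀ {P} (p : SP P) → IsSeriesOf P (series p)
    ⊔-action : ∀ {P Q f g} → SP P → SP Q → IsSeriesOf P f → IsSeriesOf Q g →
               IsSeriesOf (P ⊔ Q) (f ∙⊔ g)
    ⊕-action : ∀ {P Q f g} → SP P → SP Q → IsSeriesOf P f → IsSeriesOf Q g →
               IsSeriesOf (P ⊕ Q) (f ∙⊕ g)

  -- A power series that is the series of some SP-poset; elements are compared
  -- as power series only.
  Element : Set (sucℓ 0ℓ ⊔ℓ ℓ)
  Element = Σ[ f ∈ Series ] ∃[ P ] SP P × IsSeriesOf P f

  ⊔-rawMagma : RawMagma (sucℓ 0ℓ ⊔ℓ ℓ) 0ℓ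
  ⊔-rawMagma = record
    { Carrier = Element
    ; _≈_     = λ u v → proj₁ u ≗ proj₁ v
    ; _∙_     = λ (f , P , p , hf) (g , Q , q , hg) →
                  f ∙⊔ g , P ⊔ Q , union p q , ⊔-action p q hf hg
    }

  ⊕-rawMagma : RawMagma (sucℓ 0ℓ ⊔ℓ ℓ) 0ℓ
  ⊕-rawMagma = record
    { Carrier = Element
    ; _≈_     = λ u v → proj₁ u ≗ proj₁ v
    ; _∙_     = λ (f , P , p , hf) (g , Q , q , hg) →
                  f ∙⊕ g , P ⊕ Q , ordinal p q , ⊕-action p q hf hg
    }

ShuffleAlgebra : Set₁
ShuffleAlgebra = SeriesAlgebra IsShuffleSeries _⊙_ _⊛_

WeakOrderAlgebra : Set₁
WeakOrderAlgebra = SeriesAlgebra IsWeakOrderSeries _⊙_ _⊛⁺_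

module _ {ℓ ℓ′} {I : FinPoset → Series → Set ℓ} {J : FinPoset → Series → Set ℓ′}
         {_∙₁_ _∙₂_ _∘₁_ _∘₂_ : Op₂ Series} where

  AlgebraIsomorphism : SeriesAlgebra I _∙₁_ _∙₂_ → SeriesAlgebra J _∘₁_ _∘₂_ →
                       Set (sucℓ 0ℓ ⊔ℓ ℓ ⊔ℓ ℓ′)
  AlgebraIsomorphism 𝒜 ℬ = Σ[ φ ∈ (𝒜.Element → ℬ.Element) ]
    MagmaMorphisms.IsMagmaIsomorphism 𝒜.⊔-rawMagma ℬ.⊔-rawMagma φ ×
    MagmaMorphisms.IsMagmaIsomorphism 𝒜.⊕-rawMagma ℬ.⊕-rawMagma φ
    where
      module 𝒜 = SeriesAlgebra 𝒜
      module ℬ = SeriesAlgebra ℬ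

-- f = Σ_{1 ≤ i ≤ n} (-1)^{n-i} d_i F(⟨i⟩) with n = |P|, where F(⟨i⟩) is the
-- series of the chain ⟨i⟩ in the given algebra.  A chain is indexed by its
-- predecessor, as ⟨0⟩ is not an SP-poset.
module _ {ℓ} {I : FinPoset → Series → Set ℓ} {_∙₁_ _∙₂_ : Op₂ Series} where

  IsChainExpansion : SeriesAlgebra I _∙₁_ _∙₂_ → ∀ {P} → SP P → (ℕ → ℤ) → Set
  IsChainExpansion 𝒜 {P} p d =
    ∀ k → series p k ≡
      ∑[ j < n ] (-1ℤ ℤ.^ (n ∸ suc (toℕ j)) ℤ.* d (suc (toℕ j)) ℤ.* series (chain-SP (toℕ j)) k)
    where
      open SeriesAlgebra 𝒜
      n = FinPoset.size P

{-# OPTIONS --safe #-}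
-- A shuffle of P and ⟨n⟩ is determined by the function sending p to the number of elements of
-- ⟨n⟩ that precede p.  This number is the same along every maximal chain through p, because two
-- maximal chains of the shuffle meeting in the point labelled p can exchange their lower parts.
-- The functions that arise are exactly the order-preserving maps P → {0, …, n}: for an SP-poset,
-- each of them is realised by assembling a shuffle along the construction of P, cutting ⟨n⟩ at
-- the largest value on P in the case of P ⊕ Q.  Hence the n-th coefficient of the shuffle series
-- of P is Ω(P, n + 1), so that ℨ⁺(P) = x 𝒮ℋ(P), and multiplication by x is an isomorphism which
-- preserves linear relations.
module Submission where

open import Defs
open import Algebra.Core using (Op₂)
open import Algebra.Morphism.Structures using (module MagmaMorphisms)
open import Data.Bool.Base using (Bool; true; false)
open import Data.Fin.Base as Fin using (Fin; zero; suc; toℕ; _↑ˡ_; _↑ʳ_)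
open import Data.Fin.Permutation using (↔⇒≡)
import Data.Fin.Properties as Fin
open import Data.Integer.Base as ℤ using (ℤ; +_; 0ℤ; 1ℤ; -1ℤ)
import Data.Integer.Properties as ℤ
open import Data.Integer.Tactic.RingSolver using (solve-∀)
open import Data.List.Base using (List; []; _∷_; _++_; map; allFin; length; tabulate)
open import Data.List.Extrema.Nat using (argmax; f[xs]≤f[argmax])
open import Data.List.Membership.Propositional using (_∈_; _∉_)
open import Data.List.Membership.Propositional.Properties
  using (∈-map⁺; ∈-allFin; ∈-++⁺ˡ; ∈-++⁺ʳ; ∈-++⁻; ∈-map⁻; ∈-∃++)
open import Data.List.Properties
  using (map-injective; ∷-injective; map-id; map-∘; map-++; map-tabulate; length-tabulate)
open import Data.List.Relation.Binary.Subset.Propositional using (_⊆_)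
open import Data.List.Relation.Ternary.Interleaving as Interleaving using (_∷ˡ_; _∷ʳ_; [])
import Data.List.Relation.Ternary.Interleaving.Properties as Interleaving
open import Data.List.Relation.Ternary.Interleaving.Propositional using (Interleaving; consˡ; consʳ)
open import Data.List.Relation.Unary.All as All using (All; []; _∷_)
import Data.List.Relation.Unary.All.Properties as All
open import Data.List.Relation.Unary.AllPairs as AllPairs using (AllPairs; []; _∷_)
import Data.List.Relation.Unary.AllPairs.Properties as AllPairs
open import Data.List.Relation.Unary.Any using (here; there)
open import Data.List.Relation.Unary.Linked.Properties using (AllPairs⇒Linked; Linked⇒AllPairs)
open import Data.Nat.Base as ℕ using (ℕ; zero; suc; z≤n; s≤s; _∸_)
import Data.Nat.Properties as ℕ
open import Data.Product.Base using (∃-syntax; _×_; _,_; proj₁; proj₂; Σ-syntax; uncurry)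
open import Data.Product.Function.NonDependent.Setoid using (_×-bijection_)
open import Data.Product.Relation.Binary.Pointwise.NonDependent using (_×ₛ_)
open import Data.Sum.Base as Sum using (_⊎_; inj₁; inj₂)
open import Data.Sum.Function.Setoid using (_⊎-bijection_)
open import Data.Sum.Properties using (inj₁-injective; inj₂-injective)
open import Data.Sum.Relation.Binary.LeftOrder as LeftOrder using (₁∼₂; ₁∼₁; ₂∼₂)
open import Data.Sum.Relation.Binary.Pointwise as Pointwise using (_⊎ₛ_)
open import Data.Vec.Functional using (insertAt)
open import Data.Vec.Functional.Properties using (insertAt-lookup)
open import Function.Base using (_∘_; id)
open import Function.Bundles using (Inverse; Bijection)
open import Function.Properties.Bijection
  using (Bijection⇒Inverse) renaming (trans to bij-trans; refl to bij-refl)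
open import Function.Properties.Inverse using (Inverse⇒Bijection; ↔⇒⤖) renaming (sym to inverse-sym)
open import Level using (Level; 0ℓ)
open import Relation.Binary.Bundles using (Setoid)
import Relation.Binary.Construct.NonStrictToStrict as ToStrict
import Relation.Binary.Construct.On as On
open import Relation.Binary.Core using (Rel; _Preserves_⟶_)
open import Relation.Binary.Definitions using (Decidable; Transitive)
open import Relation.Binary.Morphism.Structures using (IsOrderIsomorphism)
open import Relation.Binary.PropositionalEquality
  using (_≡_; _≢_; refl; sym; trans; cong; subst; cong₂; subst₂; module ≡-Reasoning; _→-setoid_;
    setoid; _≗_)
open import Relation.Binary.Structures using (IsDecPartialOrder)
open import Relation.Nullary using (¬_; yes; no; contradiction; Dec; does)
open import Relation.Nullary.Decidable using (_⊎-dec_; dec-true; dec-false; decidable-stable)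
open import Algebra.Properties.Semiring.Sum ℤ.+-*-semiring using (sum-cong-≗)

-- Shuffles are compared only through their words of labels along maximal chains, so two of them
-- agree as soon as, in every such word, the same number of letters of `⟨ n ⟩` precedes each `p`;
-- their posets need not be compared. The exchange argument uses the bijection of maximal chains
-- once more: a spliced chain is again maximal in the shuffle, hence it is the image of some maximal
-- chain of `P`. Which one is irrelevant: its word contains `n` letters of `⟨ n ⟩`, and cancelling
-- the common upper part leaves equal counts below the point labelled `p`. The product formulas are
-- proved once, for the intermediate `BoundedMaps`, and carried to both algebras. For `P ⊕ Q` the
-- plain convolution of the two series overcounts: it counts a map together with a level between its
-- values on `P` and those on `Q`. Requiring the map on `P` to attain this level makes the level
-- unique. The maps on `P` that are bounded by `m` and attain it are counted by the difference of
-- consecutive coefficients, which is the origin of the factor `1-x` in both actions. On the weak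
-- order side each series carries a factor x, and the division by x removes the surplus one.

private
  variable
    a b ℓ ℓ′ : Level

-- Maximal chains

module Chains (P : FinPoset) where
  open FinPoset P
  open IsDecPartialOrder isDecPartialOrder using (antisym) renaming (refl to ≤-refl; trans to ≤-trans)

  <-trans : Transitive _<_
  <-trans = ToStrict.<-trans _≡_ _≤_ isPartialOrder

  <-asym : ∀ {x y} → x < y → ¬ (y < x)
  <-asym (x≤y , x≢y) (y≤x , _) = x≢y (antisym x≤y y≤x)

  Comparable : Rel Carrier 0ℓ
  Comparable x y = x ≤ y ⊎ y ≤ x

  comparable? : Decidable Comparable
  comparable? x y = (x ≤? y) ⊎-dec (y ≤? x)

  Chain : List Carrier → Set
  Chain = AllPairs _<_

  -- Maximality restated pointwise: a single point is tested instead of a whole larger chain. In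
  -- this form it passes to and from the pieces of a composite poset without constructing chains.
  Saturated : List Carrier → Set
  Saturated xs = ∀ z → (∀ {y} → y ∈ xs → Comparable z y) → z ∈ xs

  chain-comparable : ∀ {xs x y} → Chain xs → x ∈ xs → y ∈ xs → Comparable x y
  chain-comparable (_ ∷ _)    (here refl) (here refl) = inj₁ ≤-refl
  chain-comparable (x< ∷ _)   (here refl) (there y∈)  = inj₁ (proj₁ (All.lookup x< y∈))
  chain-comparable (x< ∷ _)   (there x∈)  (here refl) = inj₂ (proj₁ (All.lookup x< x∈))
  chain-comparable (_ ∷ ch)   (there x∈)  (there y∈)  = chain-comparable ch x∈ y∈

  -- Insertion into a sorted list. The inclusion of the result in `z ∷ xs` serves the recursion
  -- itself: it shows that the old head stays below everything after it.
  insert : ∀ z {xs} → Chain xs → (∀ {y} → y ∈ xs → Comparable z y) →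
           ∃[ ys ] Chain ys × z ∈ ys × xs ⊆ ys × ys ⊆ z ∷ xs
  insert z {[]} [] _ = z ∷ [] , [] ∷ [] , here refl , (λ ()) , id
  insert z {x ∷ xs} (x< ∷ ch) cmp with z ≟ x
  ... | yes refl = x ∷ xs , x< ∷ ch , here refl , id , there
  ... | no z≢x with cmp (here refl)
  ...   | inj₁ z≤x = z ∷ x ∷ xs , ((z≤x , z≢x) ∷ All.map (<-trans (z≤x , z≢x)) x<) ∷ x< ∷ ch
                   , here refl , there , id
  ...   | inj₂ x≤z =
    let ys , ych , z∈ , xs⊆ , ys⊆ = insert z ch (cmp ∘ there)
        x<′ : ∀ {y} → y ∈ z ∷ xs → x < y
        x<′ = λ { (here refl) → x≤z , (λ e → z≢x (sym e)) ; (there y∈) → All.lookup x< y∈ }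
    in x ∷ ys , All.tabulate (x<′ ∘ ys⊆) ∷ ych , there z∈
     , (λ { (here e) → here e ; (there y∈) → there (xs⊆ y∈) })
     , (λ { (here e) → there (here e) ; (there y∈) → skip (ys⊆ y∈) })
    where
    skip : ∀ {y} → y ∈ z ∷ xs → y ∈ z ∷ x ∷ xs
    skip (here e)  = here e
    skip (there p) = there (there p)

  saturated⇒maximal : ∀ {xs} → Saturated xs → ∀ {ys} → IsChain P ys → xs ⊆ ys → ys ⊆ xs
  saturated⇒maximal sat ych xs⊆ys z∈ys =
    sat _ (λ y∈ → chain-comparable (Linked⇒AllPairs <-trans ych) z∈ys (xs⊆ys y∈))

  maxChain : ∀ xs → Chain xs → Saturated xs → MaximalChain P
  maxChain xs ch sat = record
    { elements = xs
    ; isChain  = AllPairs⇒Linked ch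
    ; maximal  = saturated⇒maximal sat
    }

  chain : (M : MaximalChain P) → Chain (MaximalChain.elements M)
  chain M = Linked⇒AllPairs <-trans (MaximalChain.isChain M)

  saturated : (M : MaximalChain P) → Saturated (MaximalChain.elements M)
  saturated M z cmp = let _ , ych , z∈ , xs⊆ , _ = insert z (chain M) cmp
                      in MaximalChain.maximal M (AllPairs⇒Linked ych) xs⊆ z∈

  -- Greedy extension. A point rejected for being incomparable to some element stays rejected, since
  -- later steps only enlarge the chain; so one pass over `es` suffices.
  saturateIn : ∀ es {xs} → Chain xs → ∃[ ys ] Chain ys × xs ⊆ ys ×
               (∀ {z} → z ∈ es → (∀ {y} → y ∈ ys → Comparable z y) → z ∈ ys)
  saturateIn [] {xs} ch = xs , ch , id , λ ()
  saturateIn (e ∷ es) {xs} ch with All.all? (comparable? e) xs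
  ... | yes cmp =
    let zs , zch , e∈ , xs⊆ , _ = insert e ch (All.lookup cmp)
        ys , ych , zs⊆ , sat    = saturateIn es zch
    in ys , ych , zs⊆ ∘ xs⊆ , λ { (here refl) _ → zs⊆ e∈ ; (there z∈) → sat z∈ }
  ... | no ¬cmp =
    let ys , ych , xs⊆ , sat = saturateIn es ch
    in ys , ych , xs⊆ , λ { (here refl) cmp → contradiction (All.tabulate (cmp ∘ xs⊆)) ¬cmp
                          ; (there z∈) → sat z∈ }

  points : List Carrier
  points = map (Inverse.to enumeration) (allFin size)

  ∈-points : ∀ x → x ∈ points
  ∈-points x = subst (_∈ points) (strictlyInverseˡ x) (∈-map⁺ to (∈-allFin (from x)))
    where open Inverse enumeration

  extend : ∀ {xs} → Chain xs → ∃[ M ] xs ⊆ MaximalChain.elements {P} M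
  extend ch =
    let ys , ych , xs⊆ , sat = saturateIn points ch
    in maxChain ys ych (λ z → sat (∈-points z)) , xs⊆

  through₁ : ∀ p → ∃[ M ] p ∈ MaximalChain.elements {P} M
  through₁ p = let M , ⊆M = extend {p ∷ []} ([] ∷ []) in M , ⊆M (here refl)

  through₂ : ∀ {p q} → p ≤ q → ∃[ M ] p ∈ MaximalChain.elements {P} M × q ∈ MaximalChain.elements M
  through₂ {p} {q} p≤q with p ≟ q
  ... | yes refl = let M , p∈ = through₁ p in M , p∈ , p∈
  ... | no p≢q   = let M , ⊆M = extend {p ∷ q ∷ []} (((p≤q , p≢q) ∷ []) ∷ [] ∷ [])
                   in M , ⊆M (here refl) , ⊆M (there (here refl))

  chain-≡ : ∀ {xs ys} → Chain xs → Chain ys → xs ⊆ ys → ys ⊆ xs → xs ≡ ys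
  chain-≡ [] [] _ _ = refl
  chain-≡ [] (_ ∷ _) _ ys⊆ with () ← ys⊆ (here refl)
  chain-≡ (_ ∷ _) [] xs⊆ _ with () ← xs⊆ (here refl)
  chain-≡ {x ∷ xs} {y ∷ ys} (x< ∷ xch) (y< ∷ ych) xs⊆ ys⊆ with xs⊆ (here refl) | ys⊆ (here refl)
  ... | there x∈ys | there y∈xs = contradiction (All.lookup y< x∈ys) (<-asym (All.lookup x< y∈xs))
  ... | here refl  | _          = cong (x ∷_) (chain-≡ xch ych (drop x< xs⊆) (drop y< ys⊆))
    where
    drop : ∀ {x xs ys} → All (x <_) xs → x ∷ xs ⊆ x ∷ ys → xs ⊆ ys
    drop x< xs⊆ z∈ with xs⊆ (there z∈)
    ... | here refl = contradiction refl (proj₂ (All.lookup x< z∈))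
    ... | there z∈′ = z∈′
  chain-≡ (x< ∷ xch) (y< ∷ ych) xs⊆ ys⊆ | there x∈ys | here refl = contradiction refl (proj₂ (All.lookup y< x∈ys))

  chain-split : ∀ w {x s} → Chain (w ++ x ∷ s) →
                Chain w × All (_< x) w × All (x <_) s × Chain s
  chain-split []      (x<s ∷ ch)        = [] , [] , x<s , ch
  chain-split (v ∷ w) (v< ∷ ch) =
    let wch , w<x , x<s , sch = chain-split w ch
    in All.tabulate (All.lookup v< ∘ ∈-++⁺ˡ) ∷ wch , All.lookup v< (∈-++⁺ʳ w (here refl)) ∷ w<x , x<s , sch

  chain-join : ∀ {w x s} → Chain w → All (_< x) w → All (x <_) s → Chain s → Chain (w ++ x ∷ s)
  chain-join []        []          x<s sch = x<s ∷ sch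
  chain-join {v ∷ w} {x} {s} (v< ∷ wch) (v<x ∷ w<x) x<s sch = All.tabulate below ∷ chain-join wch w<x x<s sch
    where
    below : ∀ {z} → z ∈ w ++ x ∷ s → v < z
    below z∈ with ∈-++⁻ w z∈
    ... | inj₁ z∈w         = All.lookup v< z∈w
    ... | inj₂ (here refl) = v<x
    ... | inj₂ (there z∈s) = <-trans v<x (All.lookup x<s z∈s)

  -- A point comparable to the whole new chain is comparable to `x`. If it lies below `x`, it lies
  -- below all of `s` and so belongs to `M`; being at most `x`, it is not in `s`. The case above `x`
  -- is dual, with `M′` and `w′`.
  splice : ∀ (M M′ : MaximalChain P) w w′ {x s s′} →
           MaximalChain.elements M ≡ w ++ x ∷ s → MaximalChain.elements M′ ≡ w′ ++ x ∷ s′ →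
           ∃[ N ] MaximalChain.elements {P} N ≡ w ++ x ∷ s′
  splice M M′ w w′ {x} {s} {s′} eq eq′ = maxChain (w ++ x ∷ s′) (chain-join wch w<x x<s′ s′ch) sat , refl
    where
    split  = chain-split w  (subst Chain eq (chain M))
    split′ = chain-split w′ (subst Chain eq′ (chain M′))
    wch  = proj₁ split
    w<x  = proj₁ (proj₂ split)
    x<s  = proj₁ (proj₂ (proj₂ split))
    w′<x = proj₁ (proj₂ split′)
    x<s′ = proj₁ (proj₂ (proj₂ split′))
    s′ch = proj₂ (proj₂ (proj₂ split′))
    sat : Saturated (w ++ x ∷ s′)
    sat z cmp with cmp (∈-++⁺ʳ w (here refl))
    ... | inj₁ z≤x with ∈-++⁻ w (subst (z ∈_) eq (saturated M z (λ {y} y∈ → cmp′ (∈-++⁻ w (subst (y ∈_) eq y∈)))))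
      where
      cmp′ : ∀ {y} → y ∈ w ⊎ y ∈ x ∷ s → Comparable z y
      cmp′ (inj₁ y∈)          = cmp (∈-++⁺ˡ y∈)
      cmp′ (inj₂ (here refl)) = inj₁ z≤x
      cmp′ (inj₂ (there y∈))  = inj₁ (≤-trans z≤x (proj₁ (All.lookup x<s y∈)))
    ...   | inj₁ z∈w         = ∈-++⁺ˡ z∈w
    ...   | inj₂ (here refl) = ∈-++⁺ʳ w (here refl)
    ...   | inj₂ (there z∈s) = let x≤z , x≢z = All.lookup x<s z∈s in contradiction (antisym x≤z z≤x) x≢z
    sat z cmp | inj₂ x≤z with ∈-++⁻ w′ (subst (z ∈_) eq′ (saturated M′ z (λ {y} y∈ → cmp′ (∈-++⁻ w′ (subst (y ∈_) eq′ y∈)))))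
      where
      cmp′ : ∀ {y} → y ∈ w′ ⊎ y ∈ x ∷ s′ → Comparable z y
      cmp′ (inj₁ y∈) = inj₂ (≤-trans (proj₁ (All.lookup w′<x y∈)) x≤z)
      cmp′ (inj₂ y∈) = cmp (∈-++⁺ʳ w y∈)
    ...   | inj₁ z∈w′ = let z≤x , z≢x = All.lookup w′<x z∈w′ in contradiction (antisym z≤x x≤z) z≢x
    ...   | inj₂ z∈   = ∈-++⁺ʳ w z∈

-- Bijections of setoids

module _ {S : Setoid a ℓ} {T : Setoid b ℓ′} where
  private
    module S = Setoid S
    module T = Setoid T

  bijection : (f : S.Carrier → T.Carrier) → f Preserves S._≈_ ⟶ T._≈_ →
              (∀ {x y} → f x T.≈ f y → x S.≈ y) → (∀ y → ∃[ x ] f x T.≈ y) → Bijection S T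
  bijection f f-cong f-inj f-surj = record
    { to        = f
    ; cong      = f-cong
    ; bijective = f-inj , λ y → proj₁ (f-surj y) , λ z≈x → T.trans (f-cong z≈x) (proj₂ (f-surj y))
    }

  singletons : (s : S.Carrier) → (∀ x → s S.≈ x) → (t : T.Carrier) → (∀ y → t T.≈ y) → Bijection S T
  singletons s s≈ t t≈ = bijection (λ _ → t) (λ _ → T.refl)
    (λ {x} {y} _ → S.trans (S.sym (s≈ x)) (s≈ y)) (λ y → s , t≈ y)

elements : {P : FinPoset} → MaximalChain P → List (FinPoset.Carrier P)
elements = MaximalChain.elements

-- Minimal points, maximal points and maximal chains of composite posets

module Embedding {P R : FinPoset} (ι : FinPoset.Carrier P → FinPoset.Carrier R)
                 (mono : ∀ {x y} → FinPoset._≤_ P x y → FinPoset._≤_ R (ι x) (ι y))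
                 (cancel : ∀ {x y} → FinPoset._≤_ R (ι x) (ι y) → FinPoset._≤_ P x y) where
  private
    module P = FinPoset P
    module R = FinPoset R
    module CP = Chains P
    module CR = Chains R

  injective : ∀ {x y} → ι x ≡ ι y → x ≡ y
  injective {x} {y} eq = IsDecPartialOrder.antisym P.isDecPartialOrder
    (cancel (subst (ι x R.≤_) eq (IsDecPartialOrder.refl R.isDecPartialOrder)))
    (cancel (subst (R._≤ ι x) eq (IsDecPartialOrder.refl R.isDecPartialOrder)))

  mono-< : ∀ {x y} → x P.< y → ι x R.< ι y
  mono-< (x≤y , x≢y) = mono x≤y , x≢y ∘ injective

  cancel-< : ∀ {x y} → ι x R.< ι y → x P.< y
  cancel-< (x≤y , x≢y) = cancel x≤y , x≢y ∘ cong ι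

  ∈-map⁻′ : ∀ {x xs} → ι x ∈ map ι xs → x ∈ xs
  ∈-map⁻′ p with _ , y∈ , eq ← ∈-map⁻ ι p = subst (_∈ _) (sym (injective eq)) y∈

  chain⁺ : ∀ {xs} → CP.Chain xs → CR.Chain (map ι xs)
  chain⁺ = AllPairs.map⁺ ∘ AllPairs.map mono-<

  chain⁻ : ∀ {xs} → CR.Chain (map ι xs) → CP.Chain xs
  chain⁻ = AllPairs.map cancel-< ∘ AllPairs.map⁻

  comparable⁺ : ∀ {x xs} → (∀ {y} → y ∈ xs → CP.Comparable x y) →
                ∀ {y} → y ∈ map ι xs → CR.Comparable (ι x) y
  comparable⁺ cmp p with _ , y∈ , refl ← ∈-map⁻ ι p = Sum.map mono mono (cmp y∈)

  comparable⁻ : ∀ {x xs} → (∀ {y} → y ∈ map ι xs → CR.Comparable (ι x) y) →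
                ∀ {y} → y ∈ xs → CP.Comparable x y
  comparable⁻ cmp y∈ = Sum.map cancel cancel (cmp (∈-map⁺ ι y∈))

  -- Only this direction holds for every embedding. The converse depends on the points outside the
  -- image and is shown for each construction separately.
  saturated⁻ : ∀ {xs} → CR.Saturated (map ι xs) → CP.Saturated xs
  saturated⁻ sat z cmp = ∈-map⁻′ (sat (ι z) (comparable⁺ cmp))

module Transport {P Q : FinPoset} (P≅Q : P ≅ Q) where
  private
    h = proj₁ P≅Q
    module h = IsOrderIsomorphism (proj₂ P≅Q)
    module P = FinPoset P
    module Q = FinPoset Q
    module CP = Chains P
    module CQ = Chains Q
  open Embedding {P} {Q} h h.mono h.cancel

  h⁻¹ : Q.Carrier → P.Carrier
  h⁻¹ y = proj₁ (h.surjective y)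

  h∘h⁻¹ : ∀ y → h (h⁻¹ y) ≡ y
  h∘h⁻¹ y = proj₂ (h.surjective y) refl

  h⁻¹∘h : ∀ x → h⁻¹ (h x) ≡ x
  h⁻¹∘h x = injective (h∘h⁻¹ (h x))

  h⁻¹-mono : ∀ {x y} → x Q.≤ y → h⁻¹ x P.≤ h⁻¹ y
  h⁻¹-mono {x} {y} x≤y = h.cancel (subst (Q._≤ _) (sym (h∘h⁻¹ x)) (subst (x Q.≤_) (sym (h∘h⁻¹ y)) x≤y))

  minimal-≅ : Bijection (MinimalPoints P) (MinimalPoints Q)
  minimal-≅ = bijection
    (λ (x , m) → h x , λ y y≤ → trans (sym (h∘h⁻¹ y)) (cong h (m (h⁻¹ y) (h.cancel (subst (Q._≤ h x) (sym (h∘h⁻¹ y)) y≤)))))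
    (cong h) injective
    λ (y , m) → (h⁻¹ y , λ x x≤ → injective (trans (m (h x) (subst (h x Q.≤_) (h∘h⁻¹ y) (h.mono x≤))) (sym (h∘h⁻¹ y)))) , h∘h⁻¹ y

  maximal-≅ : Bijection (MaximalPoints P) (MaximalPoints Q)
  maximal-≅ = bijection
    (λ (x , m) → h x , λ y y≥ → trans (cong h (m (h⁻¹ y) (h.cancel (subst (h x Q.≤_) (sym (h∘h⁻¹ y)) y≥)))) (h∘h⁻¹ y))
    (cong h) injective
    λ (y , m) → (h⁻¹ y , λ x x≥ → injective (trans (h∘h⁻¹ y) (m (h x) (subst (Q._≤ h x) (h∘h⁻¹ y) (h.mono x≥))))) , h∘h⁻¹ y

  map-h∘h⁻¹ : ∀ ys → map h (map h⁻¹ ys) ≡ ys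
  map-h∘h⁻¹ []       = refl
  map-h∘h⁻¹ (y ∷ ys) = cong₂ _∷_ (h∘h⁻¹ y) (map-h∘h⁻¹ ys)

  chains-≅ : Bijection (MaximalChains P) (MaximalChains Q)
  chains-≅ = bijection
    (λ M → CQ.maxChain (map h (elements M)) (chain⁺ (CP.chain M))
      λ z cmp → subst (_∈ _) (h∘h⁻¹ z) (∈-map⁺ h (CP.saturated M (h⁻¹ z)
        (comparable⁻ (λ y∈ → subst (λ w → CQ.Comparable w _) (sym (h∘h⁻¹ z)) (cmp y∈))))))
    (cong (map h)) (map-injective injective)
    λ M → CP.maxChain (map h⁻¹ (elements M))
            (chain⁻ (subst CQ.Chain (sym (map-h∘h⁻¹ _)) (CQ.chain M)))
            (saturated⁻ (subst CQ.Saturated (sym (map-h∘h⁻¹ _)) (CQ.saturated M)))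
        , map-h∘h⁻¹ _

module Union (P Q : FinPoset) where
  open Pointwise using (inj₁; inj₂)
  private
    module P = FinPoset P
    module Q = FinPoset Q
    module CP = Chains P
    module CQ = Chains Q
    module C  = Chains (P ⊔ Q)
    module ι₁ = Embedding {P} {P ⊔ Q} inj₁ inj₁ Pointwise.drop-inj₁
    module ι₂ = Embedding {Q} {P ⊔ Q} inj₂ inj₂ Pointwise.drop-inj₂

  minimal-⊔ : Bijection (MinimalPoints P ⊎ₛ MinimalPoints Q) (MinimalPoints (P ⊔ Q))
  minimal-⊔ = bijection
    (λ { (inj₁ (x , m)) → inj₁ x , λ { _ (inj₁ y≤x) → cong inj₁ (m _ y≤x) }
       ; (inj₂ (x , m)) → inj₂ x , λ { _ (inj₂ y≤x) → cong inj₂ (m _ y≤x) } })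
    (λ { (inj₁ eq) → cong inj₁ eq ; (inj₂ eq) → cong inj₂ eq })
    (λ { {inj₁ _} {inj₁ _} eq → inj₁ (inj₁-injective eq) ; {inj₂ _} {inj₂ _} eq → inj₂ (inj₂-injective eq) })
    λ { (inj₁ x , m) → inj₁ (x , λ y y≤x → inj₁-injective (m (inj₁ y) (inj₁ y≤x))) , refl
      ; (inj₂ x , m) → inj₂ (x , λ y y≤x → inj₂-injective (m (inj₂ y) (inj₂ y≤x))) , refl }

  maximal-⊔ : Bijection (MaximalPoints P ⊎ₛ MaximalPoints Q) (MaximalPoints (P ⊔ Q))
  maximal-⊔ = bijection
    (λ { (inj₁ (x , m)) → inj₁ x , λ { _ (inj₁ x≤y) → cong inj₁ (m _ x≤y) }
       ; (inj₂ (x , m)) → inj₂ x , λ { _ (inj₂ x≤y) → cong inj₂ (m _ x≤y) } })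
    (λ { (inj₁ eq) → cong inj₁ eq ; (inj₂ eq) → cong inj₂ eq })
    (λ { {inj₁ _} {inj₁ _} eq → inj₁ (inj₁-injective eq) ; {inj₂ _} {inj₂ _} eq → inj₂ (inj₂-injective eq) })
    λ { (inj₁ x , m) → inj₁ (x , λ y x≤y → inj₁-injective (m (inj₁ y) (inj₁ x≤y))) , refl
      ; (inj₂ x , m) → inj₂ (x , λ y x≤y → inj₂-injective (m (inj₂ y) (inj₂ x≤y))) , refl }

  module _ (p₀ : P.Carrier) (q₀ : Q.Carrier) where
    private
      saturated₁ : ∀ {xs} → CP.Saturated xs → C.Saturated (map inj₁ xs)
      -- The empty list is saturated only in an empty poset, which `p₀` excludes; the first element
      -- of a nonempty chain is incomparable to every point of `Q`.
      saturated₁ {[]}     sat z cmp with () ← sat p₀ (λ ())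
      saturated₁ {x ∷ xs} sat (inj₁ z) cmp = ∈-map⁺ inj₁ (sat z (ι₁.comparable⁻ cmp))
      saturated₁ {x ∷ xs} sat (inj₂ z) cmp with cmp (here refl)
      ... | inj₁ ()
      ... | inj₂ ()

      saturated₂ : ∀ {xs} → CQ.Saturated xs → C.Saturated (map inj₂ xs)
      saturated₂ {[]}     sat z cmp with () ← sat q₀ (λ ())
      saturated₂ {x ∷ xs} sat (inj₂ z) cmp = ∈-map⁺ inj₂ (sat z (ι₂.comparable⁻ cmp))
      saturated₂ {x ∷ xs} sat (inj₁ z) cmp with cmp (here refl)
      ... | inj₁ ()
      ... | inj₂ ()

      all₁ : ∀ {p : P.Carrier} {zs} → All (FinPoset._<_ (P ⊔ Q) (inj₁ p)) zs → ∃[ xs ] map inj₁ xs ≡ zs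
      all₁ [] = [] , refl
      all₁ ((inj₁ _ , _) ∷ ps) with xs , refl ← all₁ ps = _ ∷ xs , refl

      all₂ : ∀ {q : Q.Carrier} {zs} → All (FinPoset._<_ (P ⊔ Q) (inj₂ q)) zs → ∃[ xs ] map inj₂ xs ≡ zs
      all₂ [] = [] , refl
      all₂ ((inj₂ _ , _) ∷ ps) with xs , refl ← all₂ ps = _ ∷ xs , refl

    chainIn : MaximalChain P ⊎ MaximalChain Q → MaximalChain (P ⊔ Q)
    chainIn (inj₁ M) = C.maxChain (map inj₁ (elements M)) (ι₁.chain⁺ (CP.chain M)) (saturated₁ (CP.saturated M))
    chainIn (inj₂ M) = C.maxChain (map inj₂ (elements M)) (ι₂.chain⁺ (CQ.chain M)) (saturated₂ (CQ.saturated M))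

    private
      nonempty : ∀ {xs : List P.Carrier} {ys : List Q.Carrier} →
                 CP.Saturated xs → ¬ (map inj₁ xs ≡ map {B = P.Carrier ⊎ Q.Carrier} inj₂ ys)
      nonempty {_ ∷ _} {[]}    _ ()
      nonempty {_ ∷ _} {_ ∷ _} _ ()
      nonempty {[]} sat _ with () ← sat p₀ (λ ())

      classify : ∀ zs → C.Chain zs → C.Saturated zs →
                 ∃[ u ] elements (chainIn u) ≡ zs
      classify [] _ sat with () ← sat (inj₁ p₀) (λ ())
      classify (inj₁ x ∷ zs) (x< ∷ ch) sat with xs , refl ← all₁ x< =
        inj₁ (CP.maxChain (x ∷ xs) (ι₁.chain⁻ (x< ∷ ch)) (ι₁.saturated⁻ sat)) , refl
      classify (inj₂ x ∷ zs) (x< ∷ ch) sat with xs , refl ← all₂ x< =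
        inj₂ (CQ.maxChain (x ∷ xs) (ι₂.chain⁻ (x< ∷ ch)) (ι₂.saturated⁻ sat)) , refl

    chains-⊔ : Bijection (MaximalChains P ⊎ₛ MaximalChains Q) (MaximalChains (P ⊔ Q))
    chains-⊔ = bijection chainIn
      (λ { (inj₁ eq) → cong (map inj₁) eq ; (inj₂ eq) → cong (map inj₂) eq })
      (λ { {inj₁ _} {inj₁ _} eq → inj₁ (map-injective inj₁-injective eq)
         ; {inj₂ _} {inj₂ _} eq → inj₂ (map-injective inj₂-injective eq)
         ; {inj₁ M} {inj₂ _} eq → contradiction eq (nonempty (CP.saturated M))
         ; {inj₂ _} {inj₁ M} eq → contradiction (sym eq) (nonempty (CP.saturated M)) })
      λ M → classify (elements M) (C.chain M) (C.saturated M)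

module Ordinal (P Q : FinPoset) where
  private
    module P = FinPoset P
    module Q = FinPoset Q
    module CP = Chains P
    module CQ = Chains Q
    module C  = Chains (P ⊕ Q)
    module ι₁ = Embedding {P} {P ⊕ Q} inj₁ ₁∼₁ LeftOrder.drop-inj₁
    module ι₂ = Embedding {Q} {P ⊕ Q} inj₂ ₂∼₂ LeftOrder.drop-inj₂

  minimal-⊕ : P.Carrier → Bijection (MinimalPoints P) (MinimalPoints (P ⊕ Q))
  minimal-⊕ p₀ = bijection
    (λ (x , m) → inj₁ x , λ { _ (₁∼₁ y≤x) → cong inj₁ (m _ y≤x) })
    (cong inj₁) inj₁-injective
    λ { (inj₁ x , m) → (x , λ y y≤x → inj₁-injective (m (inj₁ y) (₁∼₁ y≤x))) , refl
      ; (inj₂ x , m) → contradiction (m (inj₁ p₀) ₁∼₂) λ () }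

  maximal-⊕ : Q.Carrier → Bijection (MaximalPoints Q) (MaximalPoints (P ⊕ Q))
  maximal-⊕ q₀ = bijection
    (λ (x , m) → inj₂ x , λ { _ (₂∼₂ x≤y) → cong inj₂ (m _ x≤y) })
    (cong inj₂) inj₂-injective
    λ { (inj₂ x , m) → (x , λ y x≤y → inj₂-injective (m (inj₂ y) (₂∼₂ x≤y))) , refl
      ; (inj₁ x , m) → contradiction (m (inj₂ q₀) ₁∼₂) λ () }

  _⊞_ : List P.Carrier → List Q.Carrier → List (P.Carrier ⊎ Q.Carrier)
  xs ⊞ ys = map inj₁ xs ++ map inj₂ ys

  ∈⁻₁ : ∀ {x} xs ys → inj₁ x ∈ xs ⊞ ys → x ∈ xs
  ∈⁻₁ xs ys x∈ with ∈-++⁻ (map inj₁ xs) x∈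
  ... | inj₁ p = ι₁.∈-map⁻′ p
  ... | inj₂ p with () ← proj₂ (proj₂ (∈-map⁻ inj₂ p))

  ∈⁻₂ : ∀ {y} xs ys → inj₂ y ∈ xs ⊞ ys → y ∈ ys
  ∈⁻₂ xs ys y∈ with ∈-++⁻ (map inj₁ xs) y∈
  ... | inj₂ p = ι₂.∈-map⁻′ p
  ... | inj₁ p with () ← proj₂ (proj₂ (∈-map⁻ inj₁ p))

  private
    ⊞-injective : ∀ xs xs′ {ys ys′} → xs ⊞ ys ≡ xs′ ⊞ ys′ → xs ≡ xs′ × ys ≡ ys′
    ⊞-injective []       []         eq = refl , map-injective inj₂-injective eq
    ⊞-injective (_ ∷ xs) (_ ∷ xs′) eq
      with refl , eq′ ← ∷-injective eq
      with refl , refl ← ⊞-injective xs xs′ eq′ = refl , refl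
    ⊞-injective [] (_ ∷ _) {_ ∷ _} ()
    ⊞-injective (_ ∷ _) [] {_} {_ ∷ _} ()

    -- A chain never returns from `Q` to `P`, because no element of `Q` lies below one of `P`.
    split : ∀ zs → C.Chain zs → ∃[ xs ] ∃[ ys ] xs ⊞ ys ≡ zs
    split [] _ = [] , [] , refl
    split (inj₁ x ∷ zs) (_ ∷ ch) with xs , ys , refl ← split zs ch = x ∷ xs , ys , refl
    split (inj₂ y ∷ zs) (y< ∷ ch) with split zs ch
    ... | []     , ys , refl = [] , y ∷ ys , refl
    ... | x ∷ xs , ys , refl with () ← proj₁ (All.head y<)

    chain-⊞ : ∀ {xs ys} → CP.Chain xs → CQ.Chain ys → C.Chain (xs ⊞ ys)
    chain-⊞ xch ych = AllPairs.++⁺ (ι₁.chain⁺ xch) (ι₂.chain⁺ ych)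
      (All.map⁺ (All.tabulate λ _ → All.map⁺ (All.tabulate λ _ → ₁∼₂ , λ ())))

    chain-⊞⁻ : ∀ xs {ys} → C.Chain (xs ⊞ ys) → CP.Chain xs × CQ.Chain ys
    chain-⊞⁻ []       ch = [] , ι₂.chain⁻ ch
    chain-⊞⁻ (x ∷ xs) {ys} (x< ∷ ch) =
      let xch , ych = chain-⊞⁻ xs ch
      in All.tabulate (λ y∈ → ι₁.cancel-< (All.lookup x< (∈-++⁺ˡ (∈-map⁺ inj₁ y∈)))) ∷ xch , ych

    saturated-⊞ : ∀ {xs ys} → CP.Saturated xs → CQ.Saturated ys → C.Saturated (xs ⊞ ys)
    saturated-⊞ {xs} satx saty (inj₁ z) cmp = ∈-++⁺ˡ (∈-map⁺ inj₁ (satx z (ι₁.comparable⁻ (cmp ∘ ∈-++⁺ˡ))))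
    saturated-⊞ {xs} satx saty (inj₂ z) cmp = ∈-++⁺ʳ (map inj₁ xs) (∈-map⁺ inj₂ (saty z (ι₂.comparable⁻ (cmp ∘ ∈-++⁺ʳ _))))

    saturated-⊞⁻₁ : ∀ xs ys → C.Saturated (xs ⊞ ys) → CP.Saturated xs
    saturated-⊞⁻₁ xs ys sat z cmp = ∈⁻₁ xs ys (sat (inj₁ z) (λ {w} → cmp′ {w}))
      where
      cmp′ : ∀ {w} → w ∈ xs ⊞ ys → C.Comparable (inj₁ z) w
      cmp′ {inj₁ w} w∈ = Sum.map ₁∼₁ ₁∼₁ (cmp (∈⁻₁ xs ys w∈))
      cmp′ {inj₂ w} w∈ = inj₁ ₁∼₂

    saturated-⊞⁻₂ : ∀ xs ys → C.Saturated (xs ⊞ ys) → CQ.Saturated ys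
    saturated-⊞⁻₂ xs ys sat z cmp = ∈⁻₂ xs ys (sat (inj₂ z) (λ {w} → cmp′ {w}))
      where
      cmp′ : ∀ {w} → w ∈ xs ⊞ ys → C.Comparable (inj₂ z) w
      cmp′ {inj₂ w} w∈ = Sum.map ₂∼₂ ₂∼₂ (cmp (∈⁻₂ xs ys w∈))
      cmp′ {inj₁ w} w∈ = inj₂ ₁∼₂

  chains-⊕ : Bijection (MaximalChains P ×ₛ MaximalChains Q) (MaximalChains (P ⊕ Q))
  chains-⊕ = bijection
    (λ (M , N) → C.maxChain (elements M ⊞ elements N)
      (chain-⊞ (CP.chain M) (CQ.chain N)) (saturated-⊞ (CP.saturated M) (CQ.saturated N)))
    (λ (eq , eq′) → cong₂ _⊞_ eq eq′)
    (⊞-injective _ _)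
    λ M → let xs , ys , eq = split (elements M) (C.chain M)
              xch , ych = chain-⊞⁻ xs (subst C.Chain (sym eq) (C.chain M))
              sat = subst C.Saturated (sym eq) (C.saturated M)
          in (CP.maxChain xs xch (saturated-⊞⁻₁ xs ys sat) , CQ.maxChain ys ych (saturated-⊞⁻₂ xs ys sat)) , eq

module Linear (n : ℕ.ℕ) where
  open Chains ⟨ ℕ.suc n ⟩

  chain-allFin : Chain (allFin (ℕ.suc n))
  chain-allFin = AllPairs.tabulate⁺-< {f = id} λ i<j → ℕ.<⇒≤ i<j , λ { refl → ℕ.<-irrefl refl i<j }

  allChain : MaximalChain ⟨ ℕ.suc n ⟩
  allChain = maxChain (allFin (ℕ.suc n)) chain-allFin λ z _ → ∈-allFin z

  allChain-unique : ∀ M → elements allChain ≡ elements M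
  allChain-unique M = chain-≡ chain-allFin (chain M)
    (λ {z} _ → saturated M z λ {y} _ → Fin.≤-total z y) (λ {z} _ → ∈-allFin z)

  least : Setoid.Carrier (MinimalPoints ⟨ ℕ.suc n ⟩)
  least = zero , λ { zero _ → refl }

  least-unique : ∀ (x : Setoid.Carrier (MinimalPoints ⟨ ℕ.suc n ⟩)) → zero ≡ proj₁ x
  least-unique (x , m) = m zero ℕ.z≤n

  greatest : Setoid.Carrier (MaximalPoints ⟨ ℕ.suc n ⟩)
  greatest = Fin.fromℕ n , λ y n≤y → Fin.≤-antisym n≤y (Fin.≤fromℕ y)

  greatest-unique : ∀ (x : Setoid.Carrier (MaximalPoints ⟨ ℕ.suc n ⟩)) → Fin.fromℕ n ≡ proj₁ x
  greatest-unique (x , m) = sym (m (Fin.fromℕ n) (Fin.≤fromℕ x))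

-- Interleavings as words

module Words {P L : Set} where
  count : List (P ⊎ L) → ℕ
  count []           = 0
  count (inj₁ _ ∷ l) = count l
  count (inj₂ _ ∷ l) = suc (count l)

  count-++ : ∀ l l′ → count (l ++ l′) ≡ count l ℕ.+ count l′
  count-++ []           l′ = refl
  count-++ (inj₁ _ ∷ l) l′ = count-++ l l′
  count-++ (inj₂ _ ∷ l) l′ = cong suc (count-++ l l′)

  count-interleaving : ∀ {M : List P} {N : List L} {l} → Interleaving (map inj₁ M) (map inj₂ N) l → count l ≡ length N
  count-interleaving {[]}    {[]}    []         = refl
  count-interleaving {[]}    {_ ∷ _} (consʳ sp) = cong suc (count-interleaving {[]} sp)
  count-interleaving {_ ∷ _} {[]}    (consˡ sp) = count-interleaving {N = []} sp
  count-interleaving {_ ∷ _} {_ ∷ _} (consˡ sp) = count-interleaving sp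
  count-interleaving {_ ∷ _} {_ ∷ _} (consʳ sp) = cong suc (count-interleaving {_ ∷ _} sp)

  ∈-interleaving⁺ : ∀ {M : List P} {N : List L} {l p} → Interleaving (map inj₁ M) (map inj₂ N) l → p ∈ M → inj₁ p ∈ l
  ∈-interleaving⁺ {_ ∷ _} {[]}    (consˡ sp) (here refl) = here refl
  ∈-interleaving⁺ {_ ∷ _} {[]}    (consˡ sp) (there p∈)  = there (∈-interleaving⁺ {N = []} sp p∈)
  ∈-interleaving⁺ {_ ∷ _} {_ ∷ _} (consˡ sp) (here refl) = here refl
  ∈-interleaving⁺ {_ ∷ _} {_ ∷ _} (consˡ sp) (there p∈)  = there (∈-interleaving⁺ sp p∈)
  ∈-interleaving⁺ {_ ∷ _} {_ ∷ _} (consʳ sp) p∈          = there (∈-interleaving⁺ sp p∈)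

  module _ (_≟_ : (p q : P) → Dec (p ≡ q)) where

    -- If inj₁ p does not occur in l, then before p l is count l.
    before : P → List (P ⊎ L) → ℕ
    before p []           = 0
    before p (inj₂ _ ∷ l) = suc (before p l)
    before p (inj₁ q ∷ l) with p ≟ q
    ... | yes _ = 0
    ... | no  _ = before p l

    before-here : ∀ {p q} l → p ≡ q → before p (inj₁ q ∷ l) ≡ 0
    before-here {p} {q} l eq with p ≟ q
    ... | yes _  = refl
    ... | no p≢q = contradiction eq p≢q

    before-there : ∀ {p q} l → p ≢ q → before p (inj₁ q ∷ l) ≡ before p l
    before-there {p} {q} l p≢q with p ≟ q
    ... | yes eq = contradiction eq p≢q
    ... | no _   = refl

    before≤count : ∀ p l → before p l ℕ.≤ count l
    before≤count p []           = z≤n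
    before≤count p (inj₂ _ ∷ l) = s≤s (before≤count p l)
    before≤count p (inj₁ q ∷ l) with p ≟ q
    ... | yes _ = z≤n
    ... | no _  = before≤count p l

    before-++ˡ : ∀ {p} l l′ → inj₁ p ∈ l → before p (l ++ l′) ≡ before p l
    before-++ˡ (inj₂ _ ∷ l) l′ (there p∈) = cong suc (before-++ˡ l l′ p∈)
    before-++ˡ {p} (inj₁ q ∷ l) l′ p∈ with p ≟ q | p∈
    ... | yes _  | _         = refl
    ... | no p≢q | here refl = contradiction refl p≢q
    ... | no _   | there p∈′ = before-++ˡ l l′ p∈′

    before-++ʳ : ∀ {p} l l′ → inj₁ p ∉ l → before p (l ++ l′) ≡ count l ℕ.+ before p l′
    before-++ʳ []           l′ p∉ = refl
    before-++ʳ (inj₂ _ ∷ l) l′ p∉ = cong suc (before-++ʳ l l′ (p∉ ∘ there))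
    before-++ʳ {p} (inj₁ q ∷ l) l′ p∉ with p ≟ q
    ... | yes refl = contradiction (here refl) p∉
    ... | no _     = before-++ʳ l l′ (p∉ ∘ there)

    before-uncons : ∀ {p M l l′} → All (p ≢_) M →
                    (∀ {q} → q ∈ p ∷ M → before q (inj₁ p ∷ l) ≡ before q (inj₁ p ∷ l′)) →
                    ∀ {q} → q ∈ M → before q l ≡ before q l′
    before-uncons {p} p∉ eqs {q} q∈ = trans (sym (before-there _ q≢p)) (trans (eqs (there q∈)) (before-there _ q≢p))
      where
      q≢p : q ≢ p
      q≢p eq = All.lookup p∉ q∈ (sym eq)

    -- Read from the left, each letter is forced: while letters of both kinds remain, the first
    -- remaining element of `M` comes next exactly when no letter of `N` precedes it. The two mixed
    -- cases would equate zero with a successor.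
    interleaving-≡ : ∀ {M : List P} {N : List L} {l l′} → AllPairs _≢_ M →
                     Interleaving (map inj₁ M) (map inj₂ N) l → Interleaving (map inj₁ M) (map inj₂ N) l′ →
                     (∀ {p} → p ∈ M → before p l ≡ before p l′) → l ≡ l′
    interleaving-≡ {[]} {[]} _ [] [] _ = refl
    interleaving-≡ {[]} {_ ∷ _} _ (consʳ sp) (consʳ sp′) _ =
      cong (_ ∷_) (interleaving-≡ [] sp sp′ (λ ()))
    interleaving-≡ {_ ∷ _} {[]} (p∉ ∷ u) (consˡ sp) (consˡ sp′) eqs =
      cong (_ ∷_) (interleaving-≡ {N = []} u sp sp′ (before-uncons p∉ eqs))
    interleaving-≡ {_ ∷ _} {_ ∷ _} (p∉ ∷ u) (consˡ sp) (consˡ sp′) eqs =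
      cong (_ ∷_) (interleaving-≡ u sp sp′ (before-uncons p∉ eqs))
    interleaving-≡ {p ∷ M} {_ ∷ _} u (consʳ sp) (consʳ sp′) eqs =
      cong (_ ∷_) (interleaving-≡ {p ∷ M} u sp sp′ (ℕ.suc-injective ∘ eqs))
    interleaving-≡ {_ ∷ _} {_ ∷ _} _ (consˡ _) (consʳ _) eqs
      with () ← trans (sym (before-here _ refl)) (eqs (here refl))
    interleaving-≡ {_ ∷ _} {_ ∷ _} _ (consʳ _) (consˡ _) eqs
      with () ← trans (eqs (here refl)) (before-here _ refl)

open Words public

before-map : ∀ {P P′ N N′ : Set} (_≟_ : (p q : P) → Dec (p ≡ q)) (_≟′_ : (p q : P′) → Dec (p ≡ q))
             (h : P → P′) → (∀ {p q} → h p ≡ h q → p ≡ q) → (g : N → N′) →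
             ∀ p l → before _≟′_ (h p) (map (Sum.map h g) l) ≡ before _≟_ p l
before-map _≟_ _≟′_ h h-inj g p []           = refl
before-map _≟_ _≟′_ h h-inj g p (inj₂ _ ∷ l) = cong suc (before-map _≟_ _≟′_ h h-inj g p l)
before-map _≟_ _≟′_ h h-inj g p (inj₁ q ∷ l) with p ≟ q | h p ≟′ h q
... | yes _    | yes _  = refl
... | no  p≢q  | no  _  = before-map _≟_ _≟′_ h h-inj g p l
... | yes refl | no ≢   = contradiction refl ≢
... | no p≢q   | yes eq = contradiction (h-inj eq) p≢q

module _ (P : FinPoset) where
  open FinPoset P
  open Chains P

  -- The elements of the chain occur in the word in their own order, and the number of letters
  -- already passed never decreases along it. Removing a leading letter of `ns` lowers both counts
  -- by one.
  before-mono : ∀ {N : Set} {M} {ns : List N} {l} → Chain M →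
                Interleaving (map inj₁ M) (map inj₂ ns) l →
                ∀ {p q} → p ∈ M → q ∈ M → p ≤ q → before _≟_ p l ℕ.≤ before _≟_ q l
  before-mono {M = m ∷ M} {_ ∷ _} ch (consʳ sp) p∈ q∈ p≤q = s≤s (before-mono {M = m ∷ M} ch sp p∈ q∈ p≤q)
  before-mono {M = m ∷ M} {[]} {l} ch sp {p} {q} p∈ q∈ p≤q =
    ℕ.≤-trans (ℕ.≤-trans (before≤count _≟_ p l) (ℕ.≤-reflexive (count-interleaving {M = m ∷ M} {N = []} sp))) z≤n
  before-mono {M = m ∷ M} {_ ∷ _} (m< ∷ ch) (consˡ sp) {p} {q} p∈ q∈ p≤q with p ≟ m | q ≟ m
  ... | yes _  | _        = z≤n
  ... | no p≢m | no q≢m   = before-mono ch sp (tail p≢m p∈) (tail q≢m q∈) p≤q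
    where
    tail : ∀ {x} → x ≢ m → x ∈ m ∷ M → x ∈ M
    tail x≢ (here eq)  = contradiction eq x≢
    tail x≢ (there x∈) = x∈
  ... | no p≢m | yes refl with p∈
  ...   | here eq    = contradiction eq p≢m
  -- Here `q` is the head of the chain, so `p` lies strictly above it, against `p ≤ q`.
  ...   | there p∈′ with m≤p , m≢p ← All.lookup m< p∈′ =
          contradiction (m≤p , m≢p) (<-asym (p≤q , p≢m))

-- Construction of shuffles

bij-sym : {S : Setoid a ℓ} {T : Setoid b ℓ′} → Bijection S T → Bijection T S
bij-sym = Inverse⇒Bijection ∘ inverse-sym ∘ Bijection⇒Inverse

-- The count is prescribed along every maximal chain through `p`, so `realises` fixes all words of
-- the shuffle, and gluing needs no separate proof that the count is independent of the chain.
record Realisation (P : FinPoset) (n : ℕ) (f : FinPoset.Carrier P → ℕ) : Set₁ where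
  field
    shuffle  : Shuffle P n
    realises : ∀ M {p} → p ∈ elements M → before (FinPoset._≟_ P) p (Shuffle.labels shuffle M) ≡ f p

-- With parametrisations by X, Y and Z, the conditions on a shuffle of a union or an ordinal
-- sum can be checked on the pieces.
module _ {P A : FinPoset} {n : ℕ} {f : FinPoset.Carrier P → ℕ}
         (label : FinPoset.Carrier A → FinPoset.Carrier P ⊎ Fin n)
         {X Y Z : Setoid 0ℓ 0ℓ}
         (min : Bijection X (MinimalPoints P)) (min′ : Bijection X (MinimalPoints A))
         (max : Bijection Y (MaximalPoints P)) (max′ : Bijection Y (MaximalPoints A))
         (ch : Bijection Z (MaximalChains P)) (ch′ : Bijection Z (MaximalChains A)) where
  private
    open Bijection
    module C = Inverse (Bijection⇒Inverse ch)

    el : ∀ M → elements (to ch (C.from M)) ≡ elements M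
    el M = C.strictlyInverseˡ M

  realisation :
    (∀ z → Interleaving (map inj₁ (elements (to ch z))) (map inj₂ (allFin n)) (map label (elements (to ch′ z)))) →
    (∀ z {p} → p ∈ elements (to ch z) → before (FinPoset._≟_ P) p (map label (elements (to ch′ z))) ≡ f p) →
    (∀ p → ∃[ x ] label x ≡ inj₁ p × (∀ {y} → label y ≡ inj₁ p → x ≡ y)) →
    Realisation P n f
  realisation shuffles realises labelOnce = record
    { shuffle = record
      { poset       = A
      ; label       = label
      ; sameMinimal = bij-trans (bij-sym min) min′
      ; sameMaximal = bij-trans (bij-sym max) max′
      ; chains      = bij-trans (bij-sym ch) ch′
      ; shuffles    = λ M → subst (λ xs → Interleaving (map inj₁ xs) (map inj₂ (allFin n))
                          (map label (elements (to ch′ (C.from M))))) (el M) (shuffles (C.from M))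
      ; labelOnce   = labelOnce
      }
    ; realises = λ M p∈ → realises (C.from M) (subst (_ ∈_) (sym (el M)) p∈)
    }

module _ {P Q L K : Set} (h : P → Q) (g : L → K) where

  interleaving-map : ∀ {xs ys l} → Interleaving (map inj₁ xs) (map inj₂ ys) l →
                     Interleaving (map inj₁ (map h xs)) (map inj₂ (map g ys)) (map (Sum.map h g) l)
  interleaving-map {xs} {ys} {l} sp = subst₂ (λ l r → Interleaving l r _)
    (trans (sym (map-∘ xs)) (map-∘ xs)) (trans (sym (map-∘ ys)) (map-∘ ys))
    (Interleaving.map⁺ (Sum.map h g) (Sum.map h g) (Sum.map h g)
      (Interleaving.map (cong (Sum.map h g)) (cong (Sum.map h g)) sp))

  count-map : ∀ l → count (map (Sum.map h g) l) ≡ count l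
  count-map []           = refl
  count-map (inj₁ _ ∷ l) = count-map l
  count-map (inj₂ _ ∷ l) = cong suc (count-map l)

  map-inj₁⁻ : ∀ z {q} → Sum.map h g z ≡ inj₁ q → ∃[ p ] z ≡ inj₁ p × h p ≡ q
  map-inj₁⁻ (inj₁ p) refl = p , refl , refl

  inj₁∈-map⁻ : ∀ {q} l → inj₁ q ∈ map (Sum.map h g) l → ∃[ p ] h p ≡ q
  inj₁∈-map⁻ l q∈ with z , _ , eq ← ∈-map⁻ (Sum.map h g) q∈
    with p , _ , hp≡q ← map-inj₁⁻ z (sym eq) = p , hp≡q

module _ (n : ℕ) (k : Fin (suc n)) where

  private
    X = Fin 1

    label : Fin (suc n) → X ⊎ Fin n
    label = insertAt inj₂ k (inj₁ zero)

    word : ∀ M → map label (elements {⟨ suc n ⟩} M) ≡ tabulate label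
    word M = trans (cong (map label) (sym (Linear.allChain-unique n M))) (map-tabulate id label)

    inserted : ∀ {n} {L : Set} (g : Fin n → L) k →
               Interleaving (inj₁ {A = X} zero ∷ []) (tabulate (inj₂ ∘ g)) (tabulate (insertAt (inj₂ ∘ g) k (inj₁ zero)))
    inserted g zero = consˡ (rights g)
      where
      rights : ∀ {n} {L : Set} (g : Fin n → L) → Interleaving [] (tabulate (inj₂ {A = X} ∘ g)) (tabulate (inj₂ ∘ g))
      rights {zero}  g = []
      rights {suc _} g = consʳ (rights (g ∘ suc))
    inserted {suc _} g (suc k) = consʳ (inserted (g ∘ suc) k)

    before-inserted : ∀ {n} {L : Set} (g : Fin n → L) k →
                      before Fin._≟_ zero (tabulate (insertAt (inj₂ ∘ g) k (inj₁ {A = X} zero))) ≡ toℕ k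
    before-inserted         g zero    = refl
    before-inserted {suc _} g (suc k) = cong suc (before-inserted (g ∘ suc) k)

    inserted-once : ∀ {n} {L : Set} (g : Fin n → L) k {p x} → insertAt (inj₂ ∘ g) k (inj₁ {A = X} zero) x ≡ inj₁ p → k ≡ x
    inserted-once         g zero    {x = zero}  _  = refl
    inserted-once         g zero    {x = suc _} ()
    inserted-once {suc _} g (suc k) {x = zero}  ()
    inserted-once {suc _} g (suc k) {x = suc x} eq = cong suc (inserted-once (g ∘ suc) k eq)

  -- Inserting a point into a chain gives a chain, with one minimal point, one maximal point and one
  -- maximal chain, as for `⟨ 1 ⟩`; hence all three bijections are between singletons.
  realise-one : Realisation ⟨ 1 ⟩ n (λ _ → toℕ k)
  realise-one = realisation {P = ⟨ 1 ⟩} {A = ⟨ suc n ⟩} label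
    bij-refl (singletons L₁.least (L₁.least-unique) Lₙ.least Lₙ.least-unique)
    bij-refl (singletons L₁.greatest (L₁.greatest-unique) Lₙ.greatest Lₙ.greatest-unique)
    bij-refl (singletons L₁.allChain (L₁.allChain-unique) Lₙ.allChain Lₙ.allChain-unique)
    (λ M → subst₂ (λ xs → Interleaving (map inj₁ xs) (map inj₂ (allFin n))) (L₁.allChain-unique M) (sym (word Lₙ.allChain))
             (subst (λ ys → Interleaving (inj₁ zero ∷ []) ys (tabulate label)) (sym (map-tabulate id inj₂)) (inserted id k)))
    (λ { M {zero} _ → trans (cong (before Fin._≟_ zero) (word Lₙ.allChain)) (before-inserted id k) })
    (λ { zero → k , insertAt-lookup inj₂ k (inj₁ zero) , inserted-once id k })
    where
    module L₁ = Linear 0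
    module Lₙ = Linear n

module _ {P Q : FinPoset} (P≅Q : P ≅ Q) {n : ℕ} {f : FinPoset.Carrier Q → ℕ} where
  open Transport {P} {Q} P≅Q
  private
    h = proj₁ P≅Q
    module h = IsOrderIsomorphism (proj₂ P≅Q)

  realise-≅ : Realisation P n (f ∘ h) → Realisation Q n f
  realise-≅ R = realisation {A = S.poset} label
    minimal-≅ S.sameMinimal maximal-≅ S.sameMaximal chains-≅ S.chains
    (λ M → subst₂ (Interleaving _) (cong (map inj₂) (map-id (allFin n))) (sym (map-∘ (word M)))
             (interleaving-map h id (S.shuffles M)))
    (λ M p∈ → realises′ M (∈-map⁻ h p∈))
    λ q → let x , eq , unique = S.labelOnce (h⁻¹ q)
          in x , trans (cong (Sum.map h id) eq) (cong inj₁ (h∘h⁻¹ q))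
               , λ {y} eq′ → let p , eq″ , hp≡q = map-inj₁⁻ h id (S.label y) eq′
                             in unique (trans eq″ (cong inj₁ (trans (sym (h⁻¹∘h p)) (cong h⁻¹ hp≡q))))
    where
    open Realisation R
    module S = Shuffle shuffle
    label = Sum.map h id ∘ S.label
    word : ∀ M → List (FinPoset.Carrier S.poset)
    word M = elements (Bijection.to S.chains M)
    realises′ : ∀ M {q} → ∃[ p ] p ∈ elements M × q ≡ h p →
                before (FinPoset._≟_ Q) q (map label (word M)) ≡ f q
    realises′ M (p , p∈ , refl) = begin
      before (FinPoset._≟_ Q) (h p) (map label (word M))             ≡⟨ cong (before (FinPoset._≟_ Q) (h p)) (map-∘ (word M)) ⟩
      before (FinPoset._≟_ Q) (h p) (map (Sum.map h id) (S.labels M))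
        ≡⟨ before-map (FinPoset._≟_ P) (FinPoset._≟_ Q) h h.injective id p (S.labels M) ⟩
      before (FinPoset._≟_ P) p (S.labels M)                          ≡⟨ realises M p∈ ⟩
      f (h p)                                                         ∎
      where open ≡-Reasoning

module _ (P Q : FinPoset) (p₀ : FinPoset.Carrier P) (q₀ : FinPoset.Carrier Q) where
  private
    module P = FinPoset P
    module Q = FinPoset Q

  module _ {n : ℕ} {f : P.Carrier ⊎ Q.Carrier → ℕ} where
    private module P⊔Q = FinPoset (P ⊔ Q)

    -- A maximal chain stays inside one component and must meet every letter of `⟨ n ⟩` there, so
    -- each component carries its own copy of the letters.
    realise-⊔ : Realisation P n (f ∘ inj₁) → Realisation Q n (f ∘ inj₂) → Realisation (P ⊔ Q) n f
    realise-⊔ R R′ = realisation {P = P ⊔ Q} {A = S.poset ⊔ T.poset} label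
      (Union.minimal-⊔ P Q) (bij-trans (S.sameMinimal ⊎-bijection T.sameMinimal) (Union.minimal-⊔ S.poset T.poset))
      (Union.maximal-⊔ P Q) (bij-trans (S.sameMaximal ⊎-bijection T.sameMaximal) (Union.maximal-⊔ S.poset T.poset))
      (Union.chains-⊔ P Q p₀ q₀)
      (bij-trans (S.chains ⊎-bijection T.chains)
        (Union.chains-⊔ S.poset T.poset (proj₁ (S.labelOnce p₀)) (proj₁ (T.labelOnce q₀))))
      (λ { (inj₁ M) → subst₂ (Interleaving _) (cong (map inj₂) (map-id (allFin n))) (sym (word₁ M))
                        (interleaving-map inj₁ id (S.shuffles M))
         ; (inj₂ M) → subst₂ (Interleaving _) (cong (map inj₂) (map-id (allFin n))) (sym (word₂ M))
                        (interleaving-map inj₂ id (T.shuffles M)) })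
      (λ { (inj₁ M) p∈ → realises₁ M (∈-map⁻ inj₁ p∈) ; (inj₂ M) q∈ → realises₂ M (∈-map⁻ inj₂ q∈) })
      λ { (inj₁ p) → let x , eq , unique = S.labelOnce p in inj₁ x , cong (Sum.map inj₁ id) eq
            , λ { {inj₁ y} eq′ → let _ , eq″ , e = map-inj₁⁻ inj₁ id (S.label y) eq′
                                 in cong inj₁ (unique (trans eq″ (cong inj₁ (inj₁-injective e))))
                ; {inj₂ y} eq′ → contradiction (proj₂ (proj₂ (map-inj₁⁻ inj₂ id (T.label y) eq′))) λ () }
        ; (inj₂ q) → let x , eq , unique = T.labelOnce q in inj₂ x , cong (Sum.map inj₂ id) eq
            , λ { {inj₂ y} eq′ → let _ , eq″ , e = map-inj₁⁻ inj₂ id (T.label y) eq′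
                                 in cong inj₂ (unique (trans eq″ (cong inj₁ (inj₂-injective e))))
                ; {inj₁ y} eq′ → contradiction (proj₂ (proj₂ (map-inj₁⁻ inj₁ id (S.label y) eq′))) λ () } }
      where
      module S = Shuffle (Realisation.shuffle R)
      module T = Shuffle (Realisation.shuffle R′)
      label : FinPoset.Carrier (S.poset ⊔ T.poset) → (P.Carrier ⊎ Q.Carrier) ⊎ Fin n
      label (inj₁ x) = Sum.map inj₁ id (S.label x)
      label (inj₂ y) = Sum.map inj₂ id (T.label y)
      word₁ : ∀ M → map label (map inj₁ (elements (Bijection.to S.chains M))) ≡ map (Sum.map inj₁ id) (S.labels M)
      word₁ M = let xs = elements (Bijection.to S.chains M) in trans (sym (map-∘ xs)) (map-∘ xs)
      word₂ : ∀ M → map label (map inj₂ (elements (Bijection.to T.chains M))) ≡ map (Sum.map inj₂ id) (T.labels M)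
      word₂ M = let ys = elements (Bijection.to T.chains M) in trans (sym (map-∘ ys)) (map-∘ ys)
      realises₁ : ∀ M {r} → ∃[ p ] p ∈ elements M × r ≡ inj₁ p →
                  before P⊔Q._≟_ r (map label (map inj₁ (elements (Bijection.to S.chains M)))) ≡ f r
      realises₁ M (p , p∈ , refl) = trans (cong (before P⊔Q._≟_ (inj₁ p)) (word₁ M))
        (trans (before-map P._≟_ P⊔Q._≟_ inj₁ inj₁-injective id p (S.labels M)) (Realisation.realises R M p∈))
      realises₂ : ∀ M {r} → ∃[ q ] q ∈ elements M × r ≡ inj₂ q →
                  before P⊔Q._≟_ r (map label (map inj₂ (elements (Bijection.to T.chains M)))) ≡ f r
      realises₂ M (q , q∈ , refl) = trans (cong (before P⊔Q._≟_ (inj₂ q)) (word₂ M))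
        (trans (before-map Q._≟_ P⊔Q._≟_ inj₂ inj₂-injective id q (T.labels M)) (Realisation.realises R′ M q∈))

  module _ {c d : ℕ} {f : P.Carrier ⊎ Q.Carrier → ℕ} (c≤f : ∀ q → c ℕ.≤ f (inj₂ q)) where
    private
      module P⊕Q = FinPoset (P ⊕ Q)

      allFin-++ : allFin (c ℕ.+ d) ≡ map (_↑ˡ d) (allFin c) ++ map (c ↑ʳ_) (allFin d)
      allFin-++ = trans (tabulate-++ c id) (sym (cong₂ _++_ (map-tabulate id (_↑ˡ d)) (map-tabulate id (c ↑ʳ_))))
        where
        tabulate-++ : ∀ m {X : Set} (g : Fin (m ℕ.+ d) → X) → tabulate g ≡ tabulate (g ∘ (_↑ˡ d)) ++ tabulate (g ∘ (m ↑ʳ_))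
        tabulate-++ zero    g = refl
        tabulate-++ (suc m) g = cong (g zero ∷_) (tabulate-++ m (g ∘ suc))

    -- The first `c` letters are spent below and the last `d` above. A chain reaching `q` has passed
    -- all `c` lower letters, so the upper shuffle realises `f` lowered by `c`; by `c≤f` the
    -- truncated subtraction is exact.
    realise-⊕ : Realisation P c (f ∘ inj₁) → Realisation Q d (λ q → f (inj₂ q) ∸ c) → Realisation (P ⊕ Q) (c ℕ.+ d) f
    realise-⊕ R R′ = realisation {P = P ⊕ Q} {A = S.poset ⊕ T.poset} label
      (Ordinal.minimal-⊕ P Q p₀) (bij-trans S.sameMinimal (Ordinal.minimal-⊕ S.poset T.poset (proj₁ (S.labelOnce p₀))))
      (Ordinal.maximal-⊕ P Q q₀) (bij-trans T.sameMaximal (Ordinal.maximal-⊕ S.poset T.poset (proj₁ (T.labelOnce q₀))))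
      (Ordinal.chains-⊕ P Q) (bij-trans (S.chains ×-bijection T.chains) (Ordinal.chains-⊕ S.poset T.poset))
      (λ (M , N) → subst₂ (λ l r → Interleaving l r (map label
          (map inj₁ (elements (Bijection.to S.chains M)) ++ map inj₂ (elements (Bijection.to T.chains N)))))
        (sym (map-++ inj₁ (map inj₁ (elements M)) (map inj₂ (elements N))))
        (trans (sym (map-++ inj₂ (map (_↑ˡ d) (allFin c)) (map (c ↑ʳ_) (allFin d)))) (cong (map inj₂) (sym allFin-++)))
        (subst (Interleaving (map inj₁ (map inj₁ (elements M)) ++ map inj₁ (map inj₂ (elements N)))
                             (map inj₂ (map (_↑ˡ d) (allFin c)) ++ map inj₂ (map (c ↑ʳ_) (allFin d)))) (sym (word M N))
          (Interleaving.++⁺ (interleaving-map inj₁ (_↑ˡ d) (S.shuffles M)) (interleaving-map inj₂ (c ↑ʳ_) (T.shuffles N)))))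
      (λ { (M , N) {r} r∈ → trans (cong (before P⊕Q._≟_ r) (word M N)) (realises M N r r∈) })
      λ { (inj₁ p) → let x , eq , unique = S.labelOnce p in inj₁ x , cong (Sum.map inj₁ (_↑ˡ d)) eq
            , λ { {inj₁ y} eq′ → let _ , eq″ , e = map-inj₁⁻ inj₁ (_↑ˡ d) (S.label y) eq′
                                 in cong inj₁ (unique (trans eq″ (cong inj₁ (inj₁-injective e))))
                ; {inj₂ y} eq′ → contradiction (proj₂ (proj₂ (map-inj₁⁻ inj₂ (c ↑ʳ_) (T.label y) eq′))) λ () }
        ; (inj₂ q) → let x , eq , unique = T.labelOnce q in inj₂ x , cong (Sum.map inj₂ (c ↑ʳ_)) eq
            , λ { {inj₂ y} eq′ → let _ , eq″ , e = map-inj₁⁻ inj₂ (c ↑ʳ_) (T.label y) eq′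
                                 in cong inj₂ (unique (trans eq″ (cong inj₁ (inj₂-injective e))))
                ; {inj₁ y} eq′ → contradiction (proj₂ (proj₂ (map-inj₁⁻ inj₁ (_↑ˡ d) (S.label y) eq′))) λ () } }
      where
      module S = Shuffle (Realisation.shuffle R)
      module T = Shuffle (Realisation.shuffle R′)
      label : FinPoset.Carrier (S.poset ⊕ T.poset) → (P.Carrier ⊎ Q.Carrier) ⊎ Fin (c ℕ.+ d)
      label (inj₁ x) = Sum.map inj₁ (_↑ˡ d) (S.label x)
      label (inj₂ y) = Sum.map inj₂ (c ↑ʳ_) (T.label y)
      lower : ∀ M → List ((P.Carrier ⊎ Q.Carrier) ⊎ Fin (c ℕ.+ d))
      lower M = map (Sum.map inj₁ (_↑ˡ d)) (S.labels M)
      upper : ∀ N → List ((P.Carrier ⊎ Q.Carrier) ⊎ Fin (c ℕ.+ d))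
      upper N = map (Sum.map inj₂ (c ↑ʳ_)) (T.labels N)
      word : ∀ M N → map label (map inj₁ (elements (Bijection.to S.chains M)) ++ map inj₂ (elements (Bijection.to T.chains N)))
                     ≡ lower M ++ upper N
      word M N = let xs = elements (Bijection.to S.chains M) ; ys = elements (Bijection.to T.chains N) in
        trans (map-++ label (map inj₁ xs) (map inj₂ ys))
          (cong₂ _++_ (trans (sym (map-∘ xs)) (map-∘ xs)) (trans (sym (map-∘ ys)) (map-∘ ys)))
      realises : ∀ M N r → r ∈ map inj₁ (elements M) ++ map inj₂ (elements N) →
                 before P⊕Q._≟_ r (lower M ++ upper N) ≡ f r
      realises M N (inj₁ p) r∈ = begin
        before P⊕Q._≟_ (inj₁ p) (lower M ++ upper N)
          ≡⟨ before-++ˡ P⊕Q._≟_ (lower M) (upper N)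
               (∈-interleaving⁺ (interleaving-map inj₁ (_↑ˡ d) (S.shuffles M)) (∈-map⁺ inj₁ p∈)) ⟩
        before P⊕Q._≟_ (inj₁ p) (lower M)
          ≡⟨ before-map P._≟_ P⊕Q._≟_ inj₁ inj₁-injective (_↑ˡ d) p (S.labels M) ⟩
        before P._≟_ p (S.labels M)
          ≡⟨ Realisation.realises R M p∈ ⟩
        f (inj₁ p) ∎
        where
        open ≡-Reasoning
        p∈ = Ordinal.∈⁻₁ P Q (elements M) (elements N) r∈
      realises M N (inj₂ q) r∈ = begin
        before P⊕Q._≟_ (inj₂ q) (lower M ++ upper N)
          ≡⟨ before-++ʳ P⊕Q._≟_ (lower M) (upper N)
               (λ q∈ → contradiction (proj₂ (inj₁∈-map⁻ inj₁ (_↑ˡ d) (S.labels M) q∈)) λ ()) ⟩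
        count (lower M) ℕ.+ before P⊕Q._≟_ (inj₂ q) (upper N)
          ≡⟨ cong₂ ℕ._+_
               (trans (count-map inj₁ (_↑ˡ d) (S.labels M)) (trans (count-interleaving (S.shuffles M)) (length-tabulate id)))
               (trans (before-map Q._≟_ P⊕Q._≟_ inj₂ inj₂-injective (c ↑ʳ_) q (T.labels N))
                 (Realisation.realises R′ N (Ordinal.∈⁻₂ P Q (elements M) (elements N) r∈))) ⟩
        c ℕ.+ (f (inj₂ q) ∸ c)
          ≡⟨ ℕ.m+[n∸m]≡n (c≤f q) ⟩
        f (inj₂ q) ∎
        where open ≡-Reasoning

inhabited : ∀ {P} → SP P → FinPoset.Carrier P
inhabited one                = zero
inhabited (union p _)        = inj₁ (inhabited p)
inhabited (ordinal p _)      = inj₁ (inhabited p)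
inhabited (resp (h , _) p)   = h (inhabited p)

maximum : ∀ P → FinPoset.Carrier P → (f : FinPoset.Carrier P → ℕ) → ∃[ t ] (∀ p → f p ℕ.≤ f t)
maximum P p₀ f = argmax f p₀ points , λ p → All.lookup (f[xs]≤f[argmax] p₀ points) (∈-points p)
  where open Chains P

realise : ∀ {P} → SP P → ∀ n (f : FinPoset.Carrier P → ℕ) → f Preserves FinPoset._≤_ P ⟶ ℕ._≤_ →
          (∀ p → f p ℕ.≤ n) → Realisation P n f
realise one n f mono f≤n = record
  { Realisation R ; realises = λ { M {zero} p∈ → trans (Realisation.realises R M p∈) (Fin.toℕ-fromℕ< (s≤s (f≤n zero))) } }
  where R = realise-one n (Fin.fromℕ< (s≤s (f≤n zero)))
realise (union {P} {Q} p q) n f mono f≤n =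
  realise-⊔ P Q (inhabited p) (inhabited q)
    (realise p n _ (mono ∘ Pointwise.inj₁) (f≤n ∘ inj₁)) (realise q n _ (mono ∘ Pointwise.inj₂) (f≤n ∘ inj₂))
realise (ordinal {P} {Q} p q) n f mono f≤n with maximum P (inhabited p) (f ∘ inj₁)
-- The construction needs a level between the values on `P` and those on `Q`. The maximum on `P` is
-- one, because each point of `P` lies below each point of `Q`. The decomposition of `n` at this
-- level is only a propositional equation, hence the `subst`.
... | t , ≤t = subst (λ n → Realisation (P ⊕ Q) n f) (ℕ.m+[n∸m]≡n (f≤n (inj₁ t)))
  (realise-⊕ P Q (inhabited p) (inhabited q) (λ q → mono ₁∼₂)
    (realise p (f (inj₁ t)) _ (mono ∘ ₁∼₁) ≤t)
    (realise q (n ∸ f (inj₁ t)) _ (λ x≤y → ℕ.∸-monoˡ-≤ (f (inj₁ t)) (mono (₂∼₂ x≤y)))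
      (λ q → ℕ.∸-monoˡ-≤ (f (inj₁ t)) (f≤n (inj₂ q)))))
realise (resp {P} {Q} P≅Q p) n f mono f≤n =
  realise-≅ P≅Q (realise p n _ (mono ∘ IsOrderIsomorphism.mono (proj₂ P≅Q)) (f≤n ∘ proj₁ P≅Q))

-- Classification of shuffles by order-preserving maps

-- The common model of both counting problems. Values are natural numbers with a separate bound, so
-- that the bound can change while the function stays the same.
BoundedMaps : FinPoset → ℕ → Setoid 0ℓ 0ℓ
BoundedMaps P n = On.setoid
  {B = Σ[ f ∈ (P.Carrier → ℕ) ] f Preserves P._≤_ ⟶ ℕ._≤_ × (∀ p → f p ℕ.≤ n)}
  (P.Carrier →-setoid ℕ) proj₁
  where module P = FinPoset P

-- The `suc n` values are read as 0, ..., n. This shift of the index is the factor x between the two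
-- kinds of series.
weakMaps⤖ : ∀ P n → Bijection (WeakMaps P (suc n)) (BoundedMaps P n)
weakMaps⤖ P n = bijection
  (λ (f , mono) → toℕ ∘ f , mono , λ p → Fin.toℕ≤pred[n] (f p))
  (λ f≗g p → cong toℕ (f≗g p))
  (λ eq p → Fin.toℕ-injective (eq p))
  λ (f , mono , f≤n) →
    let toℕ-f = λ p → Fin.toℕ-fromℕ< (s≤s (f≤n p))
    in ((λ p → Fin.fromℕ< (s≤s (f≤n p)))
       , λ {x} {y} x≤y → subst₂ ℕ._≤_ (sym (toℕ-f x)) (sym (toℕ-f y)) (mono x≤y))
     , toℕ-f

module _ {P : FinPoset} {n : ℕ} (S : Shuffle P n) where
  private
    module P = FinPoset P
    module A = FinPoset (Shuffle.poset S)
    module CA = Chains (Shuffle.poset S)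
  open Shuffle S
  open Chains P using (through₁; through₂; chain)

  private
    Â : MaximalChain P → List A.Carrier
    Â M = elements (Bijection.to chains M)

    label-unique : ∀ {x y p} → label x ≡ inj₁ p → label y ≡ inj₁ p → x ≡ y
    label-unique {p = p} eq eq′ =
      let _ , _ , unique = labelOnce p in trans (sym (unique eq)) (unique eq′)

    count-labels : ∀ M → count (labels M) ≡ n
    count-labels M = trans (count-interleaving (shuffles M)) (length-tabulate id)

    -- Only one point carries the label `p`, so no point of the prefix `w` does, and the letters
    -- before `p` are exactly those in the word of `w`.
    factor : ∀ M {p} → p ∈ elements M →
             ∃[ w ] ∃[ x ] ∃[ s ] label x ≡ inj₁ p × Â M ≡ w ++ x ∷ s × before P._≟_ p (labels M) ≡ count (map label w)
    factor M {p} p∈ with ∈-map⁻ label (∈-interleaving⁺ (shuffles M) p∈)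
    ... | x , x∈ , lx with ∈-∃++ x∈
    ...   | w , s , eq = w , x , s , sym lx , eq , (begin
      before P._≟_ p (labels M)                                    ≡⟨ cong (before P._≟_ p ∘ map label) eq ⟩
      before P._≟_ p (map label (w ++ x ∷ s))                      ≡⟨ cong (before P._≟_ p) (map-++ label w (x ∷ s)) ⟩
      before P._≟_ p (map label w ++ label x ∷ map label s)        ≡⟨ before-++ʳ P._≟_ (map label w) _ p∉w ⟩
      count (map label w) ℕ.+ before P._≟_ p (label x ∷ map label s)
        ≡⟨ cong (λ z → count (map label w) ℕ.+ before P._≟_ p (z ∷ map label s)) (sym lx) ⟩
      count (map label w) ℕ.+ before P._≟_ p (inj₁ p ∷ map label s)
        ≡⟨ cong (count (map label w) ℕ.+_) (before-here P._≟_ (map label s) refl) ⟩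
      count (map label w) ℕ.+ 0                                    ≡⟨ ℕ.+-identityʳ _ ⟩
      count (map label w)                                          ∎)
      where
      open ≡-Reasoning
      p∉w : inj₁ p ∉ map label w
      p∉w p∈w with y , y∈ , ly ← ∈-map⁻ label p∈w =
        let _ , w<x , _ = CA.chain-split w (subst CA.Chain eq (CA.chain (Bijection.to chains M)))
        in proj₂ (All.lookup w<x y∈) (label-unique (sym ly) (sym lx))

    -- Two maximal chains of the shuffle through the point labelled p can exchange their
    -- parts below it, and both the old and the new chain have exactly n labels in ⟨n⟩.
    before-consistent : ∀ M M′ {p} → p ∈ elements M → p ∈ elements M′ →
                        before P._≟_ p (labels M) ≡ before P._≟_ p (labels M′)
    before-consistent M M′ {p} p∈ p∈′ with factor M p∈ | factor M′ p∈′
    ... | w , x , s , lx , eq , before-p | w′ , x′ , s′ , lx′ , eq′ , before-p′ with refl ← label-unique lx lx′ =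
      trans before-p (trans (ℕ.+-cancelʳ-≡ (count (map label (x ∷ s′))) _ _ (begin
        count (map label w) ℕ.+ count (map label (x ∷ s′))  ≡⟨ count-split w ⟨
        count (map label (w ++ x ∷ s′))                     ≡⟨ cong (count ∘ map label) (trans (C.strictlyInverseˡ N) N≡) ⟨
        count (labels (C.from N))                           ≡⟨ count-labels (C.from N) ⟩
        n                                                   ≡⟨ count-labels M′ ⟨
        count (labels M′)                                   ≡⟨ cong (count ∘ map label) eq′ ⟩
        count (map label (w′ ++ x ∷ s′))                    ≡⟨ count-split w′ ⟩
        count (map label w′) ℕ.+ count (map label (x ∷ s′)) ∎)) (sym before-p′))
      where
      open ≡-Reasoning
      module C = Inverse (Bijection⇒Inverse chains)
      N  = proj₁ (CA.splice (Bijection.to chains M) (Bijection.to chains M′) w w′ eq eq′)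
      N≡ = proj₂ (CA.splice (Bijection.to chains M) (Bijection.to chains M′) w w′ eq eq′)
      count-split : ∀ w → count (map label (w ++ x ∷ s′)) ≡ count (map label w) ℕ.+ count (map label (x ∷ s′))
      count-split w = trans (cong count (map-++ label w (x ∷ s′))) (count-++ (map label w) _)

  rank : P.Carrier → ℕ
  rank p = before P._≟_ p (labels (proj₁ (through₁ p)))

  rank-before : ∀ M {p} → p ∈ elements M → before P._≟_ p (labels M) ≡ rank p
  rank-before M {p} p∈ = before-consistent M (proj₁ (through₁ p)) p∈ (proj₂ (through₁ p))

  rank-mono : ∀ {p q} → p P.≤ q → rank p ℕ.≤ rank q
  rank-mono p≤q = let M , p∈ , q∈ = through₂ p≤q in
    subst₂ ℕ._≤_ (rank-before M p∈) (rank-before M q∈) (before-mono P (chain M) (shuffles M) p∈ q∈ p≤q)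

  rank≤n : ∀ p → rank p ℕ.≤ n
  rank≤n p = let M = proj₁ (through₁ p) in
    ℕ.≤-trans (before≤count P._≟_ p (labels M)) (ℕ.≤-reflexive (count-labels M))

-- Injectivity reads the value at `x` off a chain through `x`. For surjectivity, the shuffle
-- realised from `rank S` may have another poset than `S`; their words agree, which is what equality
-- in `homShuffle` asks.
shuffles⤖ : ∀ {P} → SP P → ∀ n → Bijection (BoundedMaps P n) (homShuffle P n)
shuffles⤖ {P} p n = bijection
  (λ f → shuffle (R f))
  (λ {f} {g} f≗g M → same-labels (shuffle (R f)) (shuffle (R g)) M
    λ {x} x∈ → trans (realises (R f) M x∈) (trans (f≗g x) (sym (realises (R g) M x∈))))
  (λ {f} {g} eq x → let M , x∈ = through₁ x in
    trans (sym (realises (R f) M x∈)) (trans (cong (before P._≟_ x) (eq M)) (realises (R g) M x∈)))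
  λ S → let f = rank S , (λ {x} {y} → rank-mono S {x} {y}) , rank≤n S in f , λ M → same-labels (shuffle (R f)) S M
    λ x∈ → trans (realises (R f) M x∈) (sym (rank-before S M x∈))
  where
  module P = FinPoset P
  open Chains P using (chain; through₁)
  open Realisation
  R : (f : Setoid.Carrier (BoundedMaps P n)) → Realisation P n (proj₁ f)
  R (f , mono , f≤n) = realise p n f mono f≤n
  same-labels : ∀ (S T : Shuffle P n) M →
                (∀ {x} → x ∈ elements M → before P._≟_ x (Shuffle.labels S M) ≡ before P._≟_ x (Shuffle.labels T M)) →
                Shuffle.labels S M ≡ Shuffle.labels T M
  same-labels S T M = interleaving-≡ P._≟_ (AllPairs.map proj₂ (chain M)) (Shuffle.shuffles S M) (Shuffle.shuffles T M)

-- Counting order-preserving maps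

HasSize-⤖ : {S : Setoid a ℓ} {T : Setoid b ℓ′} {z : ℤ} → Bijection S T → HasSize S z → HasSize T z
HasSize-⤖ S⤖T (k , z≡k , e) = k , z≡k , bij-trans e S⤖T

HasSize-≡ : {S : Setoid a ℓ} {z z′ : ℤ} → z ≡ z′ → HasSize S z → HasSize S z′
HasSize-≡ refl h = h

HasSize-× : {S : Setoid a ℓ} {T : Setoid b ℓ′} {y z : ℤ} →
            HasSize S y → HasSize T z → HasSize (S ×ₛ T) (y ℤ.* z)
HasSize-× (k , refl , e) (l , refl , e′) = k ℕ.* l , sym (ℤ.pos-* k l) ,
  bij-trans (↔⇒⤖ Fin.*↔×) (bij-trans (bijection id (λ { refl → refl , refl }) (uncurry (cong₂ _,_)) (λ y → y , refl , refl))
    (e ×-bijection e′))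

module _ {N : ℕ} {T : Fin N → Setoid a ℓ} {S : Setoid b ℓ′} where
  private
    module T i = Setoid (T i)
    module S = Setoid S

  -- The images of the `f i` partition `S`. Disjointness is stated apart from injectivity on each
  -- part, so that elements of different setoids `T i` are never compared.
  HasSize-∑ : (z : Fin N → ℤ) → (∀ i → HasSize (T i) (z i)) → (f : ∀ i → T.Carrier i → S.Carrier) →
              (∀ i {x y} → T._≈_ i x y → f i x S.≈ f i y) →
              (∀ {i j x y} → f i x S.≈ f j y → i ≡ j) → (∀ i {x y} → f i x S.≈ f i y → T._≈_ i x y) →
              (∀ s → ∃[ i ] ∃[ x ] f i x S.≈ s) →
              HasSize S (∑[ i < N ] z i)
  HasSize-∑ z sizes f f-cong disjoint f-inj f-surj =
    HasSize-⤖ {S = setoid _} {T = S} (bijection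
      (λ (i , j) → f i (e i j)) (λ { refl → S.refl })
      (λ {x} {y} eq → joint x y (disjoint eq) eq)
      λ s → let i , x , eq = f-surj s
                j , ej = strictlySurjective (enum i) x
            in (i , j) , S.trans (f-cong i ej) eq)
      (sizeΣ N z (λ i → proj₁ (sizes i)) (λ i → proj₁ (proj₂ (sizes i))))
    where
    open Bijection using (to; strictlySurjective; injective)
    enum : ∀ i → Bijection (setoid (Fin (proj₁ (sizes i)))) (T i)
    enum i = proj₂ (proj₂ (sizes i))
    e : ∀ i → Fin (proj₁ (sizes i)) → T.Carrier i
    e i = to (enum i)
    joint : ∀ (x y : Σ[ i ∈ Fin N ] Fin (proj₁ (sizes i))) → proj₁ x ≡ proj₁ y →
            f (proj₁ x) (e _ (proj₂ x)) S.≈ f (proj₁ y) (e _ (proj₂ y)) → x ≡ y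
    joint (i , j) (_ , j′) refl eq = cong (i ,_) (injective (enum i) (f-inj i eq))
    sizeΣ : ∀ N (z : Fin N → ℤ) (k : Fin N → ℕ) → (∀ i → z i ≡ + k i) →
            HasSize (setoid (Σ[ i ∈ Fin N ] Fin (k i))) (∑[ i < N ] z i)
    sizeΣ zero    z k z≡k = 0 , refl , bijection (λ ()) (λ { {()} }) (λ { {()} }) λ ()
    sizeΣ (suc N) z k z≡k with sizeΣ N (z ∘ suc) (k ∘ suc) (z≡k ∘ suc)
    ... | l , ∑≡l , enum′ = k zero ℕ.+ l , cong₂ ℤ._+_ (z≡k zero) ∑≡l ,
      bij-trans (↔⇒⤖ Fin.+↔⊎) (bijection
        (λ { (inj₁ j) → zero , j ; (inj₂ x) → let i , j = to enum′ x in suc i , j })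
        (λ { refl → refl })
        (λ { {inj₁ _} {inj₁ _} refl → refl
           ; {inj₂ x} {inj₂ y} eq → cong inj₂ (injective enum′ (suc-pair eq)) })
        λ { (zero , j) → inj₁ j , refl
          ; (suc i , j) → let x , eq = strictlySurjective enum′ (i , j) in inj₂ x , cong (λ (i , j) → suc i , j) eq })
      where
      suc-pair : ∀ {x y : Σ[ i ∈ Fin N ] Fin (k (suc i))} →
                 _≡_ {A = Σ[ i ∈ Fin (suc N) ] Fin (k i)} (suc (proj₁ x) , proj₂ x) (suc (proj₁ y) , proj₂ y) → x ≡ y
      suc-pair refl = refl

-- Counting by complement

record Selection {a : ℕ} (f : Fin a → Bool) (v : Bool) (k : ℕ) : Set where
  field
    select    : Fin k → Fin a
    injective : ∀ {i j} → select i ≡ select j → i ≡ j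
    selected  : ∀ i → f (select i) ≡ v
    complete  : ∀ i → f i ≡ v → ∃[ j ] select j ≡ i

module _ {a : ℕ} {f : Fin (suc a) → Bool} {v : Bool} where

  select-head : ∀ {k} → f zero ≡ v → Selection (f ∘ suc) v k → Selection f v (suc k)
  select-head {k} eq s = record
    { select    = select′
    ; injective = λ { {zero} {zero} _ → refl ; {suc _} {suc _} e → cong suc (injective (Fin.suc-injective e)) }
    ; selected  = λ { zero → eq ; (suc i) → selected i }
    ; complete  = λ { zero _ → zero , refl ; (suc i) e → let j , sj = complete i e in suc j , cong suc sj }
    }
    where
    open Selection s
    select′ : Fin (suc k) → Fin (suc a)
    select′ zero    = zero
    select′ (suc i) = suc (select i)

  select-tail : ∀ {k} → f zero ≢ v → Selection (f ∘ suc) v k → Selection f v k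
  select-tail ≢v s = record
    { select    = suc ∘ select
    ; injective = injective ∘ Fin.suc-injective
    ; selected  = selected
    ; complete  = λ { zero e → contradiction e ≢v ; (suc i) e → let j , sj = complete i e in j , cong suc sj }
    }
    where open Selection s

private
  ≢-respˡ : ∀ {x y z : Bool} → x ≡ y → y ≢ z → x ≢ z
  ≢-respˡ refl = id

partition : ∀ {a} (f : Fin a → Bool) → ∃[ k ] ∃[ l ] k ℕ.+ l ≡ a × Selection f true k × Selection f false l
partition {zero} f = 0 , 0 , refl , empty , empty
  where
  empty : ∀ {v} → Selection f v 0
  empty = record { select = id ; injective = λ { {()} } ; selected = λ () ; complete = λ () }
partition {suc a} f with partition (f ∘ suc) | f zero in eq
... | k , l , refl , s , t | true  = suc k , l , refl , select-head eq s , select-tail (≢-respˡ eq λ ()) t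
... | k , l , refl , s , t | false = k , suc l , ℕ.+-suc k l , select-tail (≢-respˡ eq λ ()) s , select-head eq t

module _ {S : Setoid a ℓ} (test : Setoid.Carrier S → Bool) where
  open Setoid S using (Carrier; _≈_)

  Selected : Bool → Setoid _ ℓ
  Selected v = On.setoid {B = Σ[ x ∈ Carrier ] test x ≡ v} S proj₁

  module _ (test-cong : ∀ {x y} → x ≈ y → test x ≡ test y) where

    -- The test splits an enumeration of `S` into two selections. The false part is then enumerated
    -- twice, with lengths `l` and `b`, which must agree; this turns the length of the true part
    -- into `a` minus `b`.
    HasSize-∖ : ∀ {y z} → HasSize S y → HasSize (Selected false) z → HasSize (Selected true) (y ℤ.- z)
    HasSize-∖ (a , refl , e) (b , refl , e′) = subtract (partition (test ∘ Bijection.to e))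
      where
      enumerate : ∀ {v k} → Selection (test ∘ Bijection.to e) v k → Bijection (setoid (Fin k)) (Selected v)
      enumerate {v} σ = bijection {T = Selected v}
        (λ i → Bijection.to e (select i) , selected i) (λ { refl → Setoid.refl S })
        (injective ∘ Bijection.injective e)
        λ (x , tx) → let i , ei = Bijection.strictlySurjective e x
                         j , sj = complete i (trans (test-cong ei) tx)
                     in j , Setoid.trans S (Setoid.reflexive S (cong (Bijection.to e) sj)) ei
        where open Selection σ
      m+n-n≡m : ∀ m n → + (m ℕ.+ n) ℤ.- + n ≡ + m
      m+n-n≡m m n = trans (ℤ.+-assoc (+ m) (+ n) (ℤ.- + n))
        (trans (cong (ℤ._+_ (+ m)) (ℤ.+-inverseʳ (+ n))) (ℤ.+-identityʳ (+ m)))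
      subtract : ∃[ k ] ∃[ l ] k ℕ.+ l ≡ a × Selection _ true k × Selection _ false l → HasSize (Selected true) (+ a ℤ.- + b)
      subtract (k , l , refl , s , t)
        with refl ← ↔⇒≡ (Bijection⇒Inverse (bij-trans {j = Selected false} (enumerate t) (bij-sym e′)))
        = k , m+n-n≡m k l , enumerate s

-- Bounded order-preserving maps on composite posets

IsBoundedMapSeries : FinPoset → Series → Set
IsBoundedMapSeries P f = ∀ n → HasSize (BoundedMaps P n) (f n)

one-bounded : IsBoundedMapSeries ⟨ 1 ⟩ (λ n → + suc n)
one-bounded n = suc n , refl , bijection
  (λ k → (λ _ → toℕ k) , (λ _ → ℕ.≤-refl) , λ _ → Fin.toℕ≤pred[n] k)
  (λ eq _ → cong toℕ eq) (λ eq → Fin.toℕ-injective (eq zero))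
  λ (f , _ , f≤n) → Fin.fromℕ< (s≤s (f≤n zero)) , λ { zero → Fin.toℕ-fromℕ< _ }

resp-bounded : ∀ {P Q f} → P ≅ Q → IsBoundedMapSeries P f → IsBoundedMapSeries Q f
resp-bounded {P} {Q} P≅Q Pf n = HasSize-⤖ {S = BoundedMaps P n} {T = BoundedMaps Q n} (bijection
  (λ (f , mono , f≤n) → f ∘ h⁻¹ , mono ∘ h⁻¹-mono , f≤n ∘ h⁻¹)
  (λ eq → eq ∘ h⁻¹)
  (λ {f} {g} eq p → trans (cong (proj₁ f) (sym (h⁻¹∘h p))) (trans (eq (proj₁ P≅Q p)) (cong (proj₁ g) (h⁻¹∘h p))))
  λ (f , mono , f≤n) → (f ∘ proj₁ P≅Q , mono ∘ IsOrderIsomorphism.mono (proj₂ P≅Q) , f≤n ∘ proj₁ P≅Q)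
                     , λ q → cong f (h∘h⁻¹ q))
  (Pf n)
  where open Transport {P} {Q} P≅Q

⊔-bounded : ∀ {P Q f g} → IsBoundedMapSeries P f → IsBoundedMapSeries Q g → IsBoundedMapSeries (P ⊔ Q) (f ⊙ g)
⊔-bounded {P} {Q} Pf Qg n = HasSize-⤖ {S = BoundedMaps P n ×ₛ BoundedMaps Q n} {T = BoundedMaps (P ⊔ Q) n} (bijection
  (λ { ((f , f-mono , f≤n) , (g , g-mono , g≤n)) →
       Sum.[ f , g ] , (λ { (Pointwise.inj₁ x≤y) → f-mono x≤y ; (Pointwise.inj₂ x≤y) → g-mono x≤y }) , Sum.[ f≤n , g≤n ] })
  (λ (eq , eq′) → Sum.[ eq , eq′ ]) (λ eq → eq ∘ inj₁ , eq ∘ inj₂)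
  λ (f , mono , f≤n) → ((f ∘ inj₁ , mono ∘ Pointwise.inj₁ , f≤n ∘ inj₁) , (f ∘ inj₂ , mono ∘ Pointwise.inj₂ , f≤n ∘ inj₂))
                     , Sum.[ (λ _ → refl) , (λ _ → refl) ])
  (HasSize-× {S = BoundedMaps P n} {T = BoundedMaps Q n} (Pf n) (Qg n))

-- The coefficients of the product by `1-x`, in the form in which they count tight maps.
difference : Series → Series
difference f zero    = f 0
difference f (suc n) = f (suc n) ℤ.- f n

module _ (P : FinPoset) (p₀ : FinPoset.Carrier P) where
  private module P = FinPoset P

  top : (P.Carrier → ℕ) → ℕ
  top f = f (proj₁ (maximum P p₀ f))

  ≤top : ∀ f p → f p ℕ.≤ top f
  ≤top f = proj₂ (maximum P p₀ f)

  top-least : ∀ f {n} → (∀ p → f p ℕ.≤ n) → top f ℕ.≤ n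
  top-least f f≤n = f≤n _

  -- The points at which `maximum` finds its values may differ for `f` and `g`; the values agree
  -- because each is a bound for the other map.
  top-cong : ∀ {f g} → (∀ p → f p ≡ g p) → top f ≡ top g
  top-cong {f} {g} eq = ℕ.≤-antisym
    (top-least f λ p → subst (ℕ._≤ top g) (sym (eq p)) (≤top g p))
    (top-least g λ p → subst (ℕ._≤ top f) (eq p) (≤top f p))

  attains : ∀ n → Setoid.Carrier (BoundedMaps P n) → Bool
  attains n (f , _) = does (top f ℕ.≟ n)

  TightMaps : ℕ → Setoid 0ℓ 0ℓ
  TightMaps n = Selected {S = BoundedMaps P n} (attains n) true

  top-tight : ∀ {n} (f : Setoid.Carrier (TightMaps n)) → top (proj₁ (proj₁ f)) ≡ n
  top-tight {n} ((f , _) , eq) = decidable-stable (top f ℕ.≟ n)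
    λ ≢n → contradiction (trans (sym eq) (dec-false (top f ℕ.≟ n) ≢n)) λ ()

  tight : ∀ f → f Preserves P._≤_ ⟶ ℕ._≤_ → Setoid.Carrier (TightMaps (top f))
  tight f mono = (f , mono , ≤top f) , dec-true (top f ℕ.≟ top f) refl

  private
    attains-cong : ∀ n {f g : Setoid.Carrier (BoundedMaps P n)} → (∀ p → proj₁ f p ≡ proj₁ g p) → attains n f ≡ attains n g
    attains-cong n eq = cong (λ m → does (m ℕ.≟ n)) (top-cong eq)

    top≢ : ∀ n (f : Setoid.Carrier (Selected {S = BoundedMaps P n} (attains n) false)) → top (proj₁ (proj₁ f)) ≢ n
    top≢ n ((f , _) , eq) top≡n = contradiction (trans (sym (dec-true (top f ℕ.≟ n) top≡n)) eq) λ ()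

  -- A map bounded by `suc n` that does not attain it is a map bounded by `n`, so the tight maps
  -- form a complement. At bound 0 every map is tight, as `P` has a point.
  tight-size : ∀ {f} → IsBoundedMapSeries P f → ∀ n → HasSize (TightMaps n) (difference f n)
  tight-size Pf zero = HasSize-⤖ {S = BoundedMaps P 0} {T = TightMaps 0} (bijection
    (λ f → f , dec-true (top (proj₁ f) ℕ.≟ 0) (ℕ.n≤0⇒n≡0 (top-least (proj₁ f) (proj₂ (proj₂ f))))) id id
    λ (f , _) → f , λ _ → refl) (Pf 0)
  tight-size Pf (suc n) = HasSize-∖ {S = BoundedMaps P (suc n)} (attains (suc n))
    (λ {x} {y} → attains-cong (suc n) {x} {y}) (Pf (suc n))
    (HasSize-⤖ {S = BoundedMaps P n} {T = Selected {S = BoundedMaps P (suc n)} (attains (suc n)) false} (bijection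
      (λ (f , mono , f≤n) → (f , mono , λ p → ℕ.m≤n⇒m≤1+n (f≤n p))
        , dec-false (top f ℕ.≟ suc n) (λ eq → ℕ.1+n≰n (subst (ℕ._≤ n) eq (top-least f f≤n))))
      id id
      λ { F@((f , mono , f≤1+n) , _) →
          (f , mono , λ p → ℕ.≤-trans (≤top f p) (ℕ.≤-pred (ℕ.≤∧≢⇒< (top-least f f≤1+n) (top≢ (suc n) F)))) , λ _ → refl })
      (Pf n))

-- The largest value m on P is a canonical place to cut: the part on P then attains its
-- bound m, and the part on Q, lowered by m, is an arbitrary map bounded by n ∸ m.
⊕-bounded : ∀ {P Q f g} → FinPoset.Carrier P → IsBoundedMapSeries P f → IsBoundedMapSeries Q g →
            IsBoundedMapSeries (P ⊕ Q) (difference f · g)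
⊕-bounded {P} {Q} {f} {g} p₀ Pf Qg n =
  HasSize-∑ {T = λ i → TightMaps P p₀ (toℕ i) ×ₛ BoundedMaps Q (n ∸ toℕ i)} {S = BoundedMaps (P ⊕ Q) n}
    (λ i → difference f (toℕ i) ℤ.* g (n ∸ toℕ i))
    (λ i → HasSize-× {S = TightMaps P p₀ (toℕ i)} {T = BoundedMaps Q (n ∸ toℕ i)} (tight-size P p₀ Pf (toℕ i)) (Qg (n ∸ toℕ i)))
    glue
    (λ i (eq , eq′) → Sum.[ eq , (λ q → cong (toℕ i ℕ.+_) (eq′ q)) ])
    (λ {i} {j} {F} {G} eq → Fin.toℕ-injective
      (trans (sym (top-tight P p₀ (proj₁ F))) (trans (top-cong P p₀ (eq ∘ inj₁)) (top-tight P p₀ (proj₁ G)))))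
    (λ i eq → eq ∘ inj₁ , λ q → ℕ.+-cancelˡ-≡ (toℕ i) _ _ (eq (inj₂ q)))
    unglue
  where
  module P = FinPoset P
  module Q = FinPoset Q
  glue : ∀ (i : Fin (suc n)) → Setoid.Carrier (TightMaps P p₀ (toℕ i) ×ₛ BoundedMaps Q (n ∸ toℕ i)) →
         Setoid.Carrier (BoundedMaps (P ⊕ Q) n)
  glue i (((f , f-mono , f≤i) , _) , (g , g-mono , g≤)) = Sum.[ f , (λ q → toℕ i ℕ.+ g q) ]
    , (λ { (₁∼₁ x≤y) → f-mono x≤y
         ; (₂∼₂ x≤y) → ℕ.+-monoʳ-≤ (toℕ i) (g-mono x≤y)
         ; (₁∼₂ {x}) → ℕ.≤-trans (f≤i x) (ℕ.m≤m+n (toℕ i) _) })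
    , Sum.[ (λ p → ℕ.≤-trans (f≤i p) i≤n)
          , (λ q → ℕ.≤-trans (ℕ.+-monoʳ-≤ (toℕ i) (g≤ q)) (ℕ.≤-reflexive (ℕ.m+[n∸m]≡n i≤n))) ]
    where i≤n = Fin.toℕ≤pred[n] i
  unglue : ∀ F → ∃[ i ] ∃[ x ] ∀ r → proj₁ (glue i x) r ≡ proj₁ F r
  unglue (h , mono , h≤n) = i
    , (subst (Setoid.Carrier ∘ TightMaps P p₀) (sym i≡t) (tight P p₀ (h ∘ inj₁) (mono ∘ ₁∼₁))
      , ((λ q → h (inj₂ q) ∸ toℕ i) , (λ x≤y → ℕ.∸-monoˡ-≤ (toℕ i) (mono (₂∼₂ x≤y)))
        , λ q → ℕ.∸-monoˡ-≤ (toℕ i) (h≤n (inj₂ q))))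
    , Sum.[ lower i≡t , (λ q → ℕ.m+[n∸m]≡n (subst (ℕ._≤ h (inj₂ q)) (sym i≡t) (mono ₁∼₂))) ]
    where
    t = top P p₀ (h ∘ inj₁)
    t≤n : t ℕ.≤ n
    t≤n = top-least P p₀ (h ∘ inj₁) (h≤n ∘ inj₁)
    i = Fin.fromℕ< (s≤s t≤n)
    i≡t : toℕ i ≡ t
    i≡t = Fin.toℕ-fromℕ< (s≤s t≤n)
    -- `toℕ i` equals the maximum `t` only propositionally, so the tight map had to be transported;
    -- the transport leaves the underlying function unchanged. Generalising `toℕ i` to `m` allows
    -- matching on the equation.
    lower : ∀ {m} (m≡t : m ≡ t) p →
            proj₁ (proj₁ (subst (Setoid.Carrier ∘ TightMaps P p₀) (sym m≡t) (tight P p₀ (h ∘ inj₁) (mono ∘ ₁∼₁)))) p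
              ≡ h (inj₁ p)
    lower refl p = refl

-- Multiplication by x

·-congˡ : ∀ {f f′} g → f ≗ f′ → f · g ≗ f′ · g
·-congˡ g f≗f′ n = sum-cong-≗ {suc n} λ i → cong (ℤ._* g (n ∸ toℕ i)) (f≗f′ (toℕ i))

·-zero : ∀ f g → (f · g) 0 ≡ f 0 ℤ.* g 0
·-zero f g = ℤ.+-identityʳ _

-- From degree two on, the zeroth term of the sum vanishes, since `1-x` has no coefficient beyond
-- degree one; the remaining terms form the same product for the shifted series.
·-1-x-suc : ∀ f n → (f · 1-x) (suc n) ≡ f (suc n) ℤ.- f n
·-1-x-suc f zero    = linear (f 0) (f 1)
  where
  linear : ∀ x y → x ℤ.* -1ℤ ℤ.+ (y ℤ.* 1ℤ ℤ.+ 0ℤ) ≡ y ℤ.- x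
  linear = solve-∀
·-1-x-suc f (suc n) = trans (cong₂ ℤ._+_ (ℤ.*-zeroʳ (f 0)) (·-1-x-suc (f ∘ suc) n)) (ℤ.+-identityˡ _)

·-1-x : ∀ f → f · 1-x ≗ difference f
·-1-x f zero    = trans (·-zero f 1-x) (ℤ.*-identityʳ (f 0))
·-1-x f (suc n) = ·-1-x-suc f n

x· : Series → Series
x· f zero    = 0ℤ
x· f (suc n) = f n

x·-·-suc : ∀ f g n → (x· f · g) (suc n) ≡ (f · g) n
x·-·-suc f g n = ℤ.+-identityˡ _

-- With the factor x on the right, the vanishing term is the last one of the sum, so it is reached
-- by peeling off terms from the front.
·-x·-suc : ∀ f g n → (f · x· g) (suc n) ≡ (f · g) n
·-x·-suc f g zero    = cong₂ ℤ._+_ {f 0 ℤ.* g 0} refl (trans (ℤ.+-identityʳ _) (ℤ.*-zeroʳ (f 1)))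
·-x·-suc f g (suc n) = cong (ℤ._+_ (f 0 ℤ.* g (suc n))) (·-x·-suc (f ∘ suc) g n)

x·-·-1-x : ∀ f → x· f · 1-x ≗ x· (f · 1-x)
x·-·-1-x f zero    = refl
x·-·-1-x f (suc n) = x·-·-suc f 1-x n

-- The product of the two shifted series carries two factors x; `_/x` cancels one and the other
-- remains in front.
x·-⊛⁺ : ∀ f g → x· f ⊛⁺ x· g ≗ x· (f ⊛ g)
x·-⊛⁺ f g n = trans (·-congˡ (x· g) (x·-·-1-x f) (suc n)) (trans (x·-·-suc (f · 1-x) (x· g) n) (shifted n))
  where
  shifted : (f · 1-x) · x· g ≗ x· (f ⊛ g)
  shifted zero    = trans (·-zero (f · 1-x) (x· g)) (ℤ.*-zeroʳ ((f · 1-x) 0))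
  shifted (suc n) = ·-x·-suc (f · 1-x) g n

x·-⊙ : ∀ f g → x· (f ⊙ g) ≗ x· f ⊙ x· g
x·-⊙ f g zero    = refl
x·-⊙ f g (suc n) = refl

x·-cong : ∀ {f g} → f ≗ g → x· f ≗ x· g
x·-cong f≗g zero    = refl
x·-cong f≗g (suc n) = f≗g n

⊛⁺-cong : ∀ f f′ g g′ → f ≗ f′ → g ≗ g′ → f ⊛⁺ g ≗ f′ ⊛⁺ g′
⊛⁺-cong f f′ g g′ f≗f′ g≗g′ n = sum-cong-≗ {suc (suc n)} λ i →
  cong₂ ℤ._*_ (·-congˡ 1-x f≗f′ (toℕ i)) (g≗g′ (suc n ∸ toℕ i))

x·-/x : ∀ f → f 0 ≡ 0ℤ → x· (f /x) ≗ f
x·-/x f f0≡0 zero    = sym f0≡0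
x·-/x f f0≡0 (suc n) = refl

-- The two algebras and their isomorphism

module _ {P : FinPoset} where

  isShuffle : ∀ f → SP P → IsBoundedMapSeries P f → IsShuffleSeries P f
  isShuffle f p Pf n = HasSize-⤖ {S = BoundedMaps P n} {T = homShuffle P n} (shuffles⤖ p n) (Pf n)

  isShuffle⁻¹ : ∀ f → SP P → IsShuffleSeries P f → IsBoundedMapSeries P f
  isShuffle⁻¹ f p Pf n = HasSize-⤖ {S = homShuffle P n} {T = BoundedMaps P n} (bij-sym (shuffles⤖ p n)) (Pf n)

isWeak : ∀ P f → IsBoundedMapSeries P f → IsWeakOrderSeries P (x· f)
isWeak P f Pf = refl , λ n →
  HasSize-⤖ {S = BoundedMaps P n} {T = WeakMaps P (suc n)} (bij-sym (weakMaps⤖ P n)) (Pf n)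

isWeak⁻¹ : ∀ P f → IsWeakOrderSeries P f → IsBoundedMapSeries P (f /x)
isWeak⁻¹ P f (_ , Pf) n = HasSize-⤖ {S = WeakMaps P (suc n)} {T = BoundedMaps P n} (weakMaps⤖ P n) (Pf n)

isWeak-≗ : ∀ P f g → f ≗ g → IsWeakOrderSeries P f → IsWeakOrderSeries P g
isWeak-≗ P f g f≗g (f0≡0 , Pf) =
  trans (sym (f≗g 0)) f0≡0 , λ n → HasSize-≡ {S = WeakMaps P (suc n)} (f≗g (suc n)) (Pf n)

⊛-bounded : ∀ {P Q} f g → SP P → IsBoundedMapSeries P f → IsBoundedMapSeries Q g → IsBoundedMapSeries (P ⊕ Q) (f ⊛ g)
⊛-bounded {P} {Q} f g p Pf Qg n = HasSize-≡ {S = BoundedMaps (P ⊕ Q) n}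
  (sym (·-congˡ g (·-1-x f) n)) (⊕-bounded {P} {Q} {f} {g} (inhabited {P} p) Pf Qg n)

-- Both algebras take their `series` from this one function, so the weak order series is by
-- definition `x·` of the shuffle series, for chains as well.
boundedSeries : ∀ {P} → SP P → Series
boundedSeries one             n = + suc n
boundedSeries (union p q)     = boundedSeries p ⊙ boundedSeries q
boundedSeries (ordinal p q)   = boundedSeries p ⊛ boundedSeries q
boundedSeries (resp _ p)      = boundedSeries p

isBounded : ∀ {P} (p : SP P) → IsBoundedMapSeries P (boundedSeries p)
isBounded one                   = one-bounded
isBounded (union {P} {Q} p q)   = ⊔-bounded {P} {Q} {boundedSeries p} {boundedSeries q} (isBounded p) (isBounded q)
isBounded (ordinal {P} {Q} p q) = ⊛-bounded {P} {Q} (boundedSeries p) (boundedSeries q) p (isBounded p) (isBounded q)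
isBounded (resp {P} {Q} P≅Q p)  = resp-bounded {P} {Q} {boundedSeries p} P≅Q (isBounded p)

shuffleAlgebra : ShuffleAlgebra
shuffleAlgebra = record
  { series   = boundedSeries
  ; isSeries = λ p → isShuffle (boundedSeries p) p (isBounded p)
  ; ⊔-action = λ {P} {Q} {f} {g} p q Pf Qg → isShuffle (f ⊙ g) (union p q)
      (⊔-bounded {P} {Q} {f} {g} (isShuffle⁻¹ f p Pf) (isShuffle⁻¹ g q Qg))
  ; ⊕-action = λ {P} {Q} {f} {g} p q Pf Qg → isShuffle (f ⊛ g) (ordinal p q)
      (⊛-bounded {P} {Q} f g p (isShuffle⁻¹ f p Pf) (isShuffle⁻¹ g q Qg))
  }

weakOrderAlgebra : WeakOrderAlgebra
weakOrderAlgebra = record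
  { series   = x· ∘ boundedSeries
  ; isSeries = λ {P} p → isWeak P (boundedSeries p) (isBounded p)
  ; ⊔-action = λ {P} {Q} {f} {g} _ _ Pf Qg →
      -- A weak order series has constant term zero, so it is `x·` of its quotient by x. The
      -- operation is carried out on the quotients and shifted back.
      isWeak-≗ (P ⊔ Q) (x· ((f /x) ⊙ (g /x))) (f ⊙ g)
        (λ n → trans (x·-⊙ (f /x) (g /x) n) (cong₂ ℤ._*_ (x·-/x f (proj₁ Pf) n) (x·-/x g (proj₁ Qg) n)))
        (isWeak (P ⊔ Q) ((f /x) ⊙ (g /x)) (⊔-bounded {P} {Q} {f /x} {g /x} (isWeak⁻¹ P f Pf) (isWeak⁻¹ Q g Qg)))
  ; ⊕-action = λ {P} {Q} {f} {g} p _ Pf Qg →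
      isWeak-≗ (P ⊕ Q) (x· ((f /x) ⊛ (g /x))) (f ⊛⁺ g)
        (λ n → trans (sym (x·-⊛⁺ (f /x) (g /x) n))
          (⊛⁺-cong (x· (f /x)) f (x· (g /x)) g (x·-/x f (proj₁ Pf)) (x·-/x g (proj₁ Qg)) n))
        (isWeak (P ⊕ Q) ((f /x) ⊛ (g /x)) (⊛-bounded {P} {Q} (f /x) (g /x) p (isWeak⁻¹ P f Pf) (isWeak⁻¹ Q g Qg)))
  }

isomorphism : AlgebraIsomorphism shuffleAlgebra weakOrderAlgebra
isomorphism = φ , magmaIsomorphism _ _ (λ u v → x·-⊙ (proj₁ u) (proj₁ v))
                , magmaIsomorphism _ _ (λ u v n → sym (x·-⊛⁺ (proj₁ u) (proj₁ v) n))
  where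
  module 𝒮 = SeriesAlgebra shuffleAlgebra
  module 𝒵 = SeriesAlgebra weakOrderAlgebra
  φ : 𝒮.Element → 𝒵.Element
  φ (f , P , p , Pf) = x· f , P , p , isWeak P f (isShuffle⁻¹ f p Pf)
  -- The magmas for the two operations share carrier and equality, so only compatibility with the
  -- operation has to be supplied for each.
  magmaIsomorphism : (_∙_ : Op₂ 𝒮.Element) (_∘_ : Op₂ 𝒵.Element) →
    (∀ u v → proj₁ (φ (u ∙ v)) ≗ proj₁ (φ u ∘ φ v)) →
    MagmaMorphisms.IsMagmaIsomorphism
      (record { Carrier = 𝒮.Element ; _≈_ = λ u v → proj₁ u ≗ proj₁ v ; _∙_ = _∙_ })
      (record { Carrier = 𝒵.Element ; _≈_ = λ u v → proj₁ u ≗ proj₁ v ; _∙_ = _∘_ }) φ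
  magmaIsomorphism _ _ homo = record
    { isMagmaMonomorphism = record
      { isMagmaHomomorphism = record
        { isRelHomomorphism = record { cong = x·-cong }
        ; homo              = homo
        }
      ; injective = λ eq n → eq (suc n)
      }
    ; surjective = λ (f , P , p , Pf) → (f /x , P , p , isShuffle (f /x) p (isWeak⁻¹ P f Pf))
                                      , λ z≗f/x n → trans (x·-cong z≗f/x n) (x·-/x f (proj₁ Pf) n)
    }

theorem3p13 : Σ[ 𝒮ℋ ∈ ShuffleAlgebra ] Σ[ ℨ⁺ ∈ WeakOrderAlgebra ]
    AlgebraIsomorphism 𝒮ℋ ℨ⁺ ×
    (∀ {P} (p : SP P) (d : ℕ → ℤ) → IsStrictCoefficients P d →
    IsChainExpansion ℨ⁺ p d → IsChainExpansion 𝒮ℋ p d)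
-- Both expansions are equations between coefficients with the same scalars. The coefficient at `k`
-- of a shuffle series is by definition the one at `suc k` of the weak order series, so the given
-- expansion is read there.
theorem3p13 = shuffleAlgebra , weakOrderAlgebra , isomorphism , λ p d _ expansion k → expansion (suc k)
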